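{- $C(13,7,5) \ge 77$, $C(14,8,6) \ge 135$, $C(15,9,7) \ge 225$ and $C(16,10,8) \ge 360$.
   Context: Let $v \ge k \ge t \ge 1$ and let $X$ be a set of $v$ points. A $t$-$(v,k,1)$ covering is a pair $(X,\mathcal{B})$ where $\mathcal{B}$ is a set of $k$-subsets of $X$ (called blocks) such that every $t$-subset of $X$ is contained in at least one block of $\mathcal{B}$. The covering number $C(v,k,t)$ is the minimum number of blocks in a $t$-$(v,k,1)$ covering. -}

module Defs where

open import Data.Bool.Properties using () renaming (_≟_ to _≟ᵇ_)
open import Data.Empty using (⊥)
open import Data.Fin.Subset using (Subset; inside; outside; _⊆_; ∣_∣)
open import Data.Fin.Subset.Properties using (anySubset?; _⊆?_; out⊆; in⊆in; ⊆-refl)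
open import Data.List.Base using (List; []; _∷_; _++_; length; map; filter)
open import Data.List.Membership.Propositional using (_∈_; lose)
open import Data.List.Membership.Propositional.Properties
  using (∈-map⁺; ∈-map⁻; ∈-++⁺ˡ; ∈-++⁺ʳ; ∈-filter⁺)
open import Data.List.Relation.Unary.All using (All; []; all?)
open import Data.List.Relation.Unary.All.Properties using (all-filter)
open import Data.List.Relation.Unary.AllPairs using ([]; _∷_)
open import Data.List.Relation.Unary.Any using (Any; here; any?)
open import Data.List.Relation.Unary.Unique.Propositional using (Unique)
import Data.List.Relation.Unary.Unique.Propositional.Properties as Unique
import Data.List.Relation.Unary.Unique.DecPropositional as DecUnique
open import Data.Nat.Base using (ℕ; zero; suc; _≤_; z≤n; s≤s)
open import Data.Nat.Properties
  using (_≟_; _≤?_; suc-injective; m≤n⇒m<n∨m≡n; ≤-pred; ≤-trans; ≤-reflexive; n≤0⇒n≡0)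
open import Data.Product.Base using (∃; _×_; _,_; proj₁; proj₂)
open import Data.Sum.Base using (inj₁; inj₂)
open import Data.Vec.Base using ([]; _∷_)
open import Data.Vec.Properties using (≡-dec; ∷-injectiveʳ)
open import Function.Base using (_∘_)
open import Relation.Binary.PropositionalEquality using (_≡_; refl; sym; cong)
open import Relation.Nullary.Decidable
  using (Dec; yes; no; True; toWitness; map′; _×-dec_; _→-dec_; ¬?; decidable-stable)
open import Relation.Nullary.Negation using (contradiction)
open import Relation.Unary using (Decidable)

-- The point set is X = Fin v.  A set of blocks is a list of subsets of X
-- without repetitions, so that its cardinality is its length.

record IsCovering (v k t : ℕ) (𝓑 : List (Subset v)) : Set where
  field
    distinct  : Unique 𝓑
    blockSize : All (λ B → ∣ B ∣ ≡ k) 𝓑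
    covers    : ∀ (T : Subset v) → ∣ T ∣ ≡ t → Any (λ B → T ⊆ B) 𝓑

CoveringOfSize : (v k t n : ℕ) → Set
CoveringOfSize v k t n = ∃ λ 𝓑 → IsCovering v k t 𝓑 × length 𝓑 ≡ n

record IsMinimum (P : ℕ → Set) (n : ℕ) : Set where
  field
    attained   : P n
    lowerBound : ∀ {m} → P m → n ≤ m

minimum : ∀ {P : ℕ → Set} → Decidable P → ∀ m → P m → ∃ (IsMinimum P)
minimum P? zero    p0 = 0 , record { attained = p0 ; lowerBound = λ _ → z≤n }
minimum {P} P? (suc m) pm with P? 0
... | yes p0 = 0 , record { attained = p0 ; lowerBound = λ _ → z≤n }
... | no ¬p0 = let n , min = minimum (P? ∘ suc) m pm in suc n , shift min
  where
  shift : ∀ {n} → IsMinimum (P ∘ suc) n → IsMinimum P (suc n)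
  shift min = record
    { attained   = IsMinimum.attained min
    ; lowerBound = λ { {zero}  p → contradiction p ¬p0
                     ; {suc _} p → s≤s (IsMinimum.lowerBound min p) }
    }

allSubsets? : ∀ {n} {P : Subset n → Set} → Decidable P → Dec (∀ S → P S)
allSubsets? P? with anySubset? (¬? ∘ P?)
... | yes (S , ¬p) = no λ all → ¬p (all S)
... | no ∄¬p       = yes λ S → decidable-stable (P? S) λ ¬p → ∄¬p (S , ¬p)

isCovering? : ∀ v k t → Decidable (IsCovering v k t)
isCovering? v k t 𝓑 = map′
  (λ (u , s , c) → record { distinct = u ; blockSize = s ; covers = c })
  (λ c → let open IsCovering c in distinct , blockSize , covers)
  (DecUnique.unique? (≡-dec _≟ᵇ_) 𝓑
    ×-dec all? (λ B → ∣ B ∣ ≟ k) 𝓑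
    ×-dec allSubsets? (λ T → (∣ T ∣ ≟ t) →-dec any? (T ⊆?_) 𝓑))

anyListOfLength? : ∀ {v} {P : List (Subset v) → Set} → Decidable P →
                   ∀ n → Dec (∃ λ 𝓑 → P 𝓑 × length 𝓑 ≡ n)
anyListOfLength? P? zero = map′
  (λ p → [] , p , refl)
  (λ { ([] , p , _) → p })
  (P? [])
anyListOfLength? P? (suc n) = map′
  (λ (B , 𝓑 , p , eq) → B ∷ 𝓑 , p , cong suc eq)
  (λ { (B ∷ 𝓑 , p , eq) → B , 𝓑 , p , suc-injective eq })
  (anySubset? λ B → anyListOfLength? (P? ∘ (B ∷_)) n)

subsets : ∀ n → List (Subset n)
subsets zero    = [] ∷ []
subsets (suc n) = map (inside ∷_) (subsets n) ++ map (outside ∷_) (subsets n)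

subsets-unique : ∀ n → Unique (subsets n)
subsets-unique zero    = [] ∷ []
subsets-unique (suc n) = Unique.++⁺
  (Unique.map⁺ ∷-injectiveʳ (subsets-unique n))
  (Unique.map⁺ ∷-injectiveʳ (subsets-unique n))
  λ (S∈ins , S∈outs) → disjoint (∈-map⁻ _ S∈ins) (∈-map⁻ _ S∈outs)
  where
  disjoint : ∀ {S} → (∃ λ p → p ∈ subsets n × S ≡ inside ∷ p) →
             (∃ λ q → q ∈ subsets n × S ≡ outside ∷ q) → ⊥
  disjoint (_ , _ , refl) (_ , _ , ())

∈-subsets : ∀ {n} (S : Subset n) → S ∈ subsets n
∈-subsets []            = here refl
∈-subsets (inside  ∷ S) = ∈-++⁺ˡ (∈-map⁺ _ (∈-subsets S))
∈-subsets (outside ∷ S) = ∈-++⁺ʳ _ (∈-map⁺ _ (∈-subsets S))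

extend : ∀ {v k} (T : Subset v) → ∣ T ∣ ≤ k → k ≤ v →
         ∃ λ B → T ⊆ B × ∣ B ∣ ≡ k
extend [] _ k≤0 = [] , ⊆-refl , sym (n≤0⇒n≡0 k≤0)
extend (inside ∷ T) (s≤s T≤k) (s≤s k≤v) =
  let B , T⊆B , eq = extend T T≤k k≤v in inside ∷ B , in⊆in T⊆B , cong suc eq
extend (outside ∷ T) T≤k k≤v with m≤n⇒m<n∨m≡n T≤k
... | inj₂ eq = outside ∷ T , ⊆-refl , eq
... | inj₁ (s≤s T≤k′) =
  let B , T⊆B , eq = extend T T≤k′ (≤-pred k≤v) in inside ∷ B , out⊆ T⊆B , cong suc eq

allBlocks-isCovering : ∀ {v k t} → t ≤ k → k ≤ v →
  IsCovering v k t (filter (λ B → ∣ B ∣ ≟ k) (subsets v))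
allBlocks-isCovering {v} {k} t≤k k≤v = record
  { distinct  = Unique.filter⁺ _ (subsets-unique v)
  ; blockSize = all-filter _ (subsets v)
  ; covers    = λ T ∣T∣≡t →
      let B , T⊆B , ∣B∣≡k = extend T (≤-trans (≤-reflexive ∣T∣≡t) t≤k) k≤v
      in lose (∈-filter⁺ (λ B → ∣ B ∣ ≟ k) (∈-subsets B) ∣B∣≡k) T⊆B
  }

minimumCovering : ∀ v k t → t ≤ k → k ≤ v → ∃ (IsMinimum (CoveringOfSize v k t))
minimumCovering v k t t≤k k≤v =
  minimum (anyListOfLength? (isCovering? v k t)) _
    (_ , allBlocks-isCovering t≤k k≤v , refl)

-- Opaque, since unfolding C at closed arguments would start an exhaustive
-- search; C-isMinimum characterises it.

opaque

  C : ∀ v k t {t≤k : True (t ≤? k)} {k≤v : True (k ≤? v)} → ℕ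
  C v k t {t≤k} {k≤v} = proj₁ (minimumCovering v k t (toWitness t≤k) (toWitness k≤v))

  C-isMinimum : ∀ v k t {t≤k : True (t ≤? k)} {k≤v : True (k ≤? v)} →
                IsMinimum (CoveringOfSize v k t) (C v k t {t≤k} {k≤v})
  C-isMinimum v k t {t≤k} {k≤v} =
    proj₂ (minimumCovering v k t (toWitness t≤k) (toWitness k≤v))

-- By the Schönheim inequality v C(v-1,k-1,t-1) ≤ k C(v,k,t) it suffices to show C(12,6,4) ≥ 41.
--
-- In a (12,6,4) covering every triple lies in at least 3 blocks, and for any two points at most four triples through
-- them attain 3; hence pairs have degree at least 9, points at least 20, and there are at least 40 blocks.  If there
-- are exactly 40, then every point has degree 20 and a unique mate with which it has degree 10; the other pairs have
-- degree 9.  The nine blocks through two points that are not mates form one of the four (10,4,2) coverings with nine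
-- blocks.  Linear programming duality, applied to the blocks through only one of the two points, excludes three of
-- these and shows in the fourth that the two mates lie in the same blocks.  So every block is a union of three pairs
-- of mates or a transversal of the six pairs.  Counting the transversals on four pairs gives a positive integer
-- function on the vertices of a 4-cube with sum 5 on every 2-face, which does not exist.

module Submission where

open import Defs
open import Data.Bool.Base using (Bool; true; false; _∧_; _∨_; not; if_then_else_)
open import Data.Bool.ListAction using (all; any)
open import Data.Bool.Properties using (T-≡; ∧-zeroʳ; ∧-identityʳ) renaming (_≟_ to _≟ᵇ_)
open import Data.Empty using (⊥; ⊥-elim)
open import Data.Fin using (#_)
open import Data.Fin.Base using (Fin; zero; suc; punchIn; punchOut)
import Data.Fin.Properties as Fin
open import Data.Fin.Subset using (Subset; inside; outside; ∣_∣)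
import Data.Fin.Subset as Subset
open import Data.Fin.Subset.Properties using (∣⊥∣≡0)
open import Data.List.Base using (List; []; _∷_; _++_; length; map; filter; tabulate; allFin; concatMap)
open import Data.List.Membership.Propositional using (_∈_; _∉_; find)
open import Data.List.Membership.Propositional.Properties
  using (∈-++⁺ˡ; ∈-++⁺ʳ; ∈-++⁻; ∈-map⁺; ∈-map⁻; ∈-filter⁺; ∈-filter⁻; ∈-allFin; ∈-∃++)
open import Data.List.Membership.Propositional.Properties.WithK using (unique∧set⇒bag)
open import Data.List.Properties
  using (map-++; length-++; length-tabulate; length-map; map-tabulate; tabulate-cong; filter-accept; filter-reject)
open import Data.List.Relation.Binary.BagAndSetEquality using (∼bag⇒↭)
open import Data.List.Relation.Binary.Permutation.Propositional as ↭ using (_↭_)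
open import Data.List.Relation.Binary.Permutation.Propositional.Properties using (map⁺; ↭-length; ∈-resp-↭; ++-comm)
open import Data.List.Relation.Unary.All as All using (All; []; _∷_)
import Data.List.Relation.Unary.All.Properties as All
open import Data.List.Relation.Unary.AllPairs as AllPairs using ([]; _∷_)
open import Data.List.Relation.Unary.Any as Any using (Any; here; there)
open import Data.List.Relation.Unary.Unique.Propositional using (Unique)
import Data.List.Relation.Unary.Unique.Propositional.Properties as Unique
import Data.List.Relation.Unary.Unique.DecPropositional as DecUnique
open import Data.Nat.Base
  using (ℕ; zero; suc; _+_; _*_; _∸_; _≤_; _<_; _≥_; _≤ᵇ_; _<ᵇ_; z≤n; s≤s)
open import Data.Nat.DivMod using (_mod_)
open import Data.Nat.ListAction using (sum)
open import Data.Nat.ListAction.Properties using (sum-++; sum-↭)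
import Data.Nat.Properties as ℕ
open import Data.Nat.Solver using (module +-*-Solver)
open import Data.Product.Base using (∃; _×_; _,_; proj₁; proj₂)
open import Data.Sum.Base using (inj₁; inj₂)
open import Data.Vec.Base as Vec using (Vec; []; _∷_; lookup; _[_]≔_)
open import Data.Vec.Properties
  using (≡-dec; lookup∘tabulate; lookup∘update; lookup∘update′; []=⇒lookup; lookup⇒[]=; lookup-replicate)
open import Function.Base using (_∘_; id)
open import Function.Bundles using (Equivalence; mk⇔)
open import Function.Definitions using (Injective)
open import Relation.Binary.PropositionalEquality
  using (_≡_; _≢_; refl; sym; trans; cong; cong₂; subst; subst₂; setoid; ≢-sym; module ≡-Reasoning)
open import Relation.Nullary.Decidable using (Dec; does; yes; no; True; toWitness; ¬?; _×-dec_; _→-dec_)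
open import Relation.Nullary.Negation using (¬_; contradiction)

-- Counting and rounding alone stop at 40 blocks, and 40 would give only 75 for (13,7,5); so the
-- work lies in excluding coverings with exactly 40 blocks. A direct search for forty blocks on
-- twelve points is out of reach. What makes this case rigid is that the rounding loses almost
-- nothing: 6 · 40 equals 12 · 20, and 5 · 20 exceeds 11 · 9 by one. That single unit is the mate.
--
-- Exhaustive search is therefore confined to the blocks through two fixed points, where only ten
-- points remain. All conclusions about other blocks come from linear inequalities between degrees
-- with explicit integer weights, which are checked on each of the 924 six-subsets. Except in one
-- case the programs use the position of the mate of 0, because then every other pair through 0 has
-- degree at most 9; automorphisms of the nine blocks reduce the possible positions to one.

private variable
  m n k t : ℕ

-- Degrees and coverings

⟦_⟧ : Bool → ℕ
⟦ false ⟧ = 0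
⟦ true  ⟧ = 1

infix 4.5 _⊑_

_⊑_ : List (Fin n) → Subset n → Bool
xs ⊑ B = all (lookup B) xs

deg : List (Subset n) → List (Fin n) → ℕ
deg 𝓑 xs = sum (map (λ B → ⟦ xs ⊑ B ⟧) 𝓑)

⊑⇒∈ : ∀ (B : Subset n) xs {x} → xs ⊑ B ≡ true → x ∈ xs → lookup B x ≡ true
⊑⇒∈ B (x ∷ xs) p x∈ with lookup B x in eq
⊑⇒∈ B (x ∷ xs) p (here refl) | true = eq
⊑⇒∈ B (x ∷ xs) p (there x∈) | true = ⊑⇒∈ B xs p x∈

∈⇒⊑ : ∀ (B : Subset n) xs → (∀ {x} → x ∈ xs → lookup B x ≡ true) → xs ⊑ B ≡ true
∈⇒⊑ B []       p = refl
∈⇒⊑ B (x ∷ xs) p rewrite p (here refl) = ∈⇒⊑ B xs (p ∘ there)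

⟦⟧-mono : ∀ {b c} → (b ≡ true → c ≡ true) → ⟦ b ⟧ ≤ ⟦ c ⟧
⟦⟧-mono {false} p = z≤n
⟦⟧-mono {true}  p rewrite p refl = ℕ.≤-refl

sum-map-mono : ∀ {A : Set} {f g : A → ℕ} {xs} → All (λ x → f x ≤ g x) xs → sum (map f xs) ≤ sum (map g xs)
sum-map-mono []       = z≤n
sum-map-mono (p ∷ ps) = ℕ.+-mono-≤ p (sum-map-mono ps)

⊑-antitone : ∀ {xs ys} (B : Subset n) → (∀ {x} → x ∈ xs → x ∈ ys) → ⟦ ys ⊑ B ⟧ ≤ ⟦ xs ⊑ B ⟧
⊑-antitone {xs = xs} {ys} B s = ⟦⟧-mono λ p → ∈⇒⊑ B xs λ x∈ → ⊑⇒∈ B ys p (s x∈)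

deg-antitone : ∀ 𝓑 (xs ys : List (Fin n)) → (∀ {x} → x ∈ xs → x ∈ ys) → deg 𝓑 ys ≤ deg 𝓑 xs
deg-antitone 𝓑 xs ys s = sum-map-mono (All.universal (λ B → ⊑-antitone B s) 𝓑)

-- The two degrees compare block by block, so equal totals force agreement at every block. This
-- turns a bound on degrees into a statement about individual blocks.
deg≥⇒⊑ : ∀ 𝓑 (xs ys : List (Fin n)) → (∀ {x} → x ∈ xs → x ∈ ys) → deg 𝓑 xs ≤ deg 𝓑 ys →
         All (λ B → xs ⊑ B ≡ true → ys ⊑ B ≡ true) 𝓑
deg≥⇒⊑ []      xs ys s le = []
deg≥⇒⊑ (B ∷ 𝓑) xs ys s le =
  let p , le′ = split (xs ⊑ B) (ys ⊑ B) (⊑-antitone B s) (deg-antitone 𝓑 xs ys s) le in p ∷ deg≥⇒⊑ 𝓑 xs ys s le′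
  where
  split : ∀ a b {c d} → ⟦ b ⟧ ≤ ⟦ a ⟧ → d ≤ c → ⟦ a ⟧ + c ≤ ⟦ b ⟧ + d → (a ≡ true → b ≡ true) × c ≤ d
  split false false _ _   le = (λ ()) , le
  split true  true  _ _   le = (λ _ → refl) , ℕ.≤-pred le
  split true  false _ d≤c le = contradiction d≤c (ℕ.<⇒≱ le)

deg-[] : ∀ (𝓑 : List (Subset n)) → deg 𝓑 [] ≡ length 𝓑
deg-[] []      = refl
deg-[] (B ∷ 𝓑) = cong suc (deg-[] 𝓑)

-- Point sets are lists without repetitions here, so that relabelling is a map over lists and
-- degrees can be evaluated.
record Cover (v k t : ℕ) (𝓑 : List (Subset v)) : Set where
  field
    sizes  : All (λ B → ∣ B ∣ ≡ k) 𝓑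
    covers : ∀ xs → Unique xs → length xs ≡ t → 1 ≤ deg 𝓑 xs

fromPoints : List (Fin n) → Subset n
fromPoints []       = Subset.⊥
fromPoints (x ∷ xs) = fromPoints xs [ x ]≔ inside

fromPoints-∉ : ∀ (xs : List (Fin n)) {y} → All (y ≢_) xs → lookup (fromPoints xs) y ≡ outside
fromPoints-∉ []       {y} []         = lookup-replicate y outside
fromPoints-∉ (x ∷ xs) {y} (y≢x ∷ ps) = trans (lookup∘update′ y≢x (fromPoints xs) inside) (fromPoints-∉ xs ps)

fromPoints-∈ : ∀ (xs : List (Fin n)) {x} → x ∈ xs → lookup (fromPoints xs) x ≡ inside
fromPoints-∈ (x ∷ xs) (here refl) = lookup∘update x (fromPoints xs) inside
fromPoints-∈ (x ∷ xs) {y} (there y∈) with y Fin.≟ x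
... | yes refl = lookup∘update x (fromPoints xs) inside
... | no y≢x   = trans (lookup∘update′ y≢x (fromPoints xs) inside) (fromPoints-∈ xs y∈)

∣insert∣ : ∀ (S : Subset n) x → lookup S x ≡ outside → ∣ S [ x ]≔ inside ∣ ≡ suc ∣ S ∣
∣insert∣ (outside ∷ S) zero    eq = refl
∣insert∣ (outside ∷ S) (suc x) eq = ∣insert∣ S x eq
∣insert∣ (inside  ∷ S) (suc x) eq = cong suc (∣insert∣ S x eq)

∣fromPoints∣ : ∀ {xs : List (Fin n)} → Unique xs → ∣ fromPoints xs ∣ ≡ length xs
∣fromPoints∣ {n} []        = ∣⊥∣≡0 n
∣fromPoints∣ {xs = x ∷ xs} (p ∷ u) = trans (∣insert∣ (fromPoints xs) x (fromPoints-∉ xs p)) (cong suc (∣fromPoints∣ u))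

Any⇒1≤deg : ∀ xs {𝓑 : List (Subset n)} → Any (λ B → xs ⊑ B ≡ true) 𝓑 → 1 ≤ deg 𝓑 xs
Any⇒1≤deg xs (here p) rewrite p = s≤s z≤n
Any⇒1≤deg xs {B ∷ 𝓑} (there a) = ℕ.≤-trans (Any⇒1≤deg xs a) (ℕ.m≤n+m (deg 𝓑 xs) ⟦ xs ⊑ B ⟧)

isCovering⇒cover : ∀ {𝓑} → IsCovering n k t 𝓑 → Cover n k t 𝓑
isCovering⇒cover c = record
  { sizes  = IsCovering.blockSize c
  ; covers = λ xs u len → Any⇒1≤deg xs (Any.map
      (λ {B} T⊆B → ∈⇒⊑ B xs λ {x} x∈ → []=⇒lookup (T⊆B (lookup⇒[]= x _ (fromPoints-∈ xs x∈))))
      (IsCovering.covers c (fromPoints xs) (trans (∣fromPoints∣ u) len)))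
  }

-- Relabelled and derived coverings

∣∣≡sum : ∀ (B : Subset n) → ∣ B ∣ ≡ sum (tabulate (⟦_⟧ ∘ lookup B))
∣∣≡sum []            = refl
∣∣≡sum (inside  ∷ B) = cong suc (∣∣≡sum B)
∣∣≡sum (outside ∷ B) = ∣∣≡sum B

sum-punchIn : ∀ (f : Fin (suc n) → ℕ) i → sum (tabulate f) ≡ f i + sum (tabulate (f ∘ punchIn i))
sum-punchIn f zero = refl
sum-punchIn {suc n} f (suc i) = begin
  f zero + sum (tabulate (f ∘ suc))                          ≡⟨ cong (f zero +_) (sum-punchIn (f ∘ suc) i) ⟩
  f zero + (f (suc i) + sum (tabulate (f ∘ suc ∘ punchIn i))) ≡⟨ solve 3 (λ a b c → a :+ (b :+ c) := b :+ (a :+ c)) refl (f zero) (f (suc i)) _ ⟩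
  f (suc i) + (f zero + sum (tabulate (f ∘ suc ∘ punchIn i))) ∎
  where open ≡-Reasoning
        open +-*-Solver using (solve; _:=_; _:+_)

-- An injection of a finite set into itself is a permutation: remove `zero` from the source and its
-- value from the target, and recurse.
sum-injective : ∀ (f : Fin n → ℕ) (π : Fin n → Fin n) → Injective _≡_ _≡_ π →
                sum (tabulate (f ∘ π)) ≡ sum (tabulate f)
sum-injective {zero}  f π inj = refl
sum-injective {suc n} f π inj = sym (begin
  sum (tabulate f)                                              ≡⟨ sum-punchIn f (π zero) ⟩
  f (π zero) + sum (tabulate (f ∘ punchIn (π zero)))            ≡⟨ cong (f (π zero) +_) (sum-injective (f ∘ punchIn (π zero)) π′ π′-inj) ⟨
  f (π zero) + sum (tabulate (f ∘ punchIn (π zero) ∘ π′))       ≡⟨ cong (λ l → f (π zero) + sum l) (tabulate-cong (cong f ∘ λ i → Fin.punchIn-punchOut (ne i))) ⟩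
  f (π zero) + sum (tabulate (f ∘ π ∘ suc))                     ∎)
  where
  open ≡-Reasoning
  ne : ∀ i → π zero ≢ π (suc i)
  ne i eq with () ← inj eq
  π′ : Fin n → Fin n
  π′ i = punchOut (ne i)
  π′-inj : Injective _≡_ _≡_ π′
  π′-inj eq = Fin.suc-injective (inj (Fin.punchOut-injective (ne _) (ne _) eq))

pull : (Fin m → Fin n) → Subset n → Subset m
pull π B = Vec.tabulate (lookup B ∘ π)

⊑-pull : ∀ (π : Fin m → Fin n) B xs → xs ⊑ pull π B ≡ map π xs ⊑ B
⊑-pull π B []       = refl
⊑-pull π B (x ∷ xs) = cong₂ _∧_ (lookup∘tabulate (lookup B ∘ π) x) (⊑-pull π B xs)

deg-pull : ∀ (π : Fin m → Fin n) 𝓑 xs → deg (map (pull π) 𝓑) xs ≡ deg 𝓑 (map π xs)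
deg-pull π []      xs = refl
deg-pull π (B ∷ 𝓑) xs = cong₂ _+_ (cong ⟦_⟧ (⊑-pull π B xs)) (deg-pull π 𝓑 xs)

∣pull∣ : ∀ (π : Fin m → Fin n) B → ∣ pull π B ∣ ≡ sum (tabulate (⟦_⟧ ∘ lookup B ∘ π))
∣pull∣ π B = trans (∣∣≡sum (pull π B)) (cong sum (tabulate-cong (cong ⟦_⟧ ∘ lookup∘tabulate (lookup B ∘ π))))

cover-relabel : ∀ {π : Fin n → Fin n} → Injective _≡_ _≡_ π → ∀ {𝓑} → Cover n k t 𝓑 → Cover n k t (map (pull π) 𝓑)
cover-relabel {π = π} inj {𝓑} c = record
  { sizes  = All.map⁺ (All.map (λ {B} eq → trans (∣pull∣ π B) (trans (sum-injective _ π inj) (trans (sym (∣∣≡sum B)) eq))) (Cover.sizes c))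
  ; covers = λ xs u len → subst (1 ≤_) (sym (deg-pull π 𝓑 xs))
      (Cover.covers c (map π xs) (Unique.map⁺ inj u) (trans (length-map π xs) len))
  }

private
  through : Fin n → List (Subset n) → List (Subset n)
  through x []      = []
  through x (B ∷ 𝓑) with lookup B x
  ... | true  = B ∷ through x 𝓑
  ... | false = through x 𝓑

  deg-through : ∀ (x : Fin n) 𝓑 xs → deg (through x 𝓑) xs ≡ deg 𝓑 (x ∷ xs)
  deg-through x []      xs = refl
  deg-through x (B ∷ 𝓑) xs with lookup B x
  ... | true  = cong (⟦ xs ⊑ B ⟧ +_) (deg-through x 𝓑 xs)
  ... | false = deg-through x 𝓑 xs

  sizes-through : ∀ (x : Fin (suc n)) 𝓑 → All (λ B → ∣ B ∣ ≡ suc k) 𝓑 → All (λ B → ∣ pull (punchIn x) B ∣ ≡ k) (through x 𝓑)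
  sizes-through x []      []       = []
  sizes-through x (B ∷ 𝓑) (p ∷ ps) with lookup B x in eq
  ... | false = sizes-through x 𝓑 ps
  ... | true  = ℕ.suc-injective (begin
      suc ∣ pull (punchIn x) B ∣                                              ≡⟨ cong suc (∣pull∣ (punchIn x) B) ⟩
      suc (sum (tabulate (⟦_⟧ ∘ lookup B ∘ punchIn x)))                      ≡⟨ cong (λ b → ⟦ b ⟧ + sum (tabulate (⟦_⟧ ∘ lookup B ∘ punchIn x))) eq ⟨
      ⟦ lookup B x ⟧ + sum (tabulate (⟦_⟧ ∘ lookup B ∘ punchIn x))           ≡⟨ sum-punchIn (⟦_⟧ ∘ lookup B) x ⟨
      sum (tabulate (⟦_⟧ ∘ lookup B))                                        ≡⟨ ∣∣≡sum B ⟨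
      ∣ B ∣                                                                   ≡⟨ p ⟩
      suc _                                                                   ∎) ∷ sizes-through x 𝓑 ps
    where open ≡-Reasoning

derived : Fin (suc n) → List (Subset (suc n)) → List (Subset n)
derived x 𝓑 = map (pull (punchIn x)) (through x 𝓑)

deg-derived : ∀ (x : Fin (suc n)) 𝓑 xs → deg (derived x 𝓑) xs ≡ deg 𝓑 (x ∷ map (punchIn x) xs)
deg-derived x 𝓑 xs = trans (deg-pull (punchIn x) (through x 𝓑) xs) (deg-through x 𝓑 (map (punchIn x) xs))

cover-derived : ∀ (x : Fin (suc n)) {𝓑} → Cover (suc n) (suc k) (suc t) 𝓑 → Cover n k t (derived x 𝓑)
cover-derived x {𝓑} c = record
  { sizes  = All.map⁺ (sizes-through x 𝓑 (Cover.sizes c))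
  ; covers = λ xs u len → subst (1 ≤_) (sym (deg-derived x 𝓑 xs))
      (Cover.covers c _ (All.map⁺ (All.universal (λ y → Fin.punchInᵢ≢i x y ∘ sym) xs) ∷ Unique.map⁺ (Fin.punchIn-injective x _ _) u)
        (cong suc (trans (length-map _ xs) len)))
  }

-- Double counting

sum-tabulate-+ : ∀ (f g : Fin n → ℕ) → sum (tabulate (λ i → f i + g i)) ≡ sum (tabulate f) + sum (tabulate g)
sum-tabulate-+ {zero}  f g = refl
sum-tabulate-+ {suc n} f g = trans (cong (f zero + g zero +_) (sum-tabulate-+ (f ∘ suc) (g ∘ suc)))
  (solve 4 (λ a b c d → a :+ b :+ (c :+ d) := a :+ c :+ (b :+ d)) refl (f zero) (g zero) _ _)
  where open +-*-Solver using (solve; _:=_; _:+_)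

sum-tabulate-0 : ∀ n → sum (tabulate {n = n} (λ _ → 0)) ≡ 0
sum-tabulate-0 zero    = refl
sum-tabulate-0 (suc n) = sum-tabulate-0 n

-- Double counting of the flags (w, B) with xs ⊆ B and w ∈ B.
sum-deg : ∀ {𝓑 : List (Subset n)} → All (λ B → ∣ B ∣ ≡ k) 𝓑 → ∀ xs →
          sum (tabulate (λ w → deg 𝓑 (w ∷ xs))) ≡ k * deg 𝓑 xs
sum-deg {n} {k} {[]}    []       xs = trans (sum-tabulate-0 n) (sym (ℕ.*-zeroʳ k))
sum-deg {n} {k} {B ∷ 𝓑} (p ∷ ps) xs = begin
  sum (tabulate (λ w → ⟦ w ∷ xs ⊑ B ⟧ + deg 𝓑 (w ∷ xs)))                             ≡⟨ sum-tabulate-+ (λ w → ⟦ w ∷ xs ⊑ B ⟧) (λ w → deg 𝓑 (w ∷ xs)) ⟩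
  sum (tabulate (λ w → ⟦ w ∷ xs ⊑ B ⟧)) + sum (tabulate (λ w → deg 𝓑 (w ∷ xs)))     ≡⟨ cong₂ _+_ flags (sum-deg ps xs) ⟩
  k * ⟦ xs ⊑ B ⟧ + k * deg 𝓑 xs                                                     ≡⟨ ℕ.*-distribˡ-+ k ⟦ xs ⊑ B ⟧ (deg 𝓑 xs) ⟨
  k * deg (B ∷ 𝓑) xs                                                                ∎
  where
  open ≡-Reasoning
  flags : sum (tabulate (λ w → ⟦ w ∷ xs ⊑ B ⟧)) ≡ k * ⟦ xs ⊑ B ⟧
  flags with xs ⊑ B
  ... | false = trans (cong sum (tabulate-cong (λ w → cong ⟦_⟧ (∧-zeroʳ (lookup B w))))) (trans (sum-tabulate-0 n) (sym (ℕ.*-zeroʳ k)))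
  ... | true  = trans (cong sum (tabulate-cong (λ w → cong ⟦_⟧ (∧-identityʳ (lookup B w))))) (trans (sym (∣∣≡sum B)) (trans p (sym (ℕ.*-identityʳ k))))

sum-tabulate-≥ : ∀ {f : Fin n → ℕ} {c} → (∀ i → c ≤ f i) → n * c ≤ sum (tabulate f)
sum-tabulate-≥ {zero}  h = z≤n
sum-tabulate-≥ {suc n} h = ℕ.+-mono-≤ (h zero) (sum-tabulate-≥ (h ∘ suc))

-- The blocks through a point, with the point removed, form a covering with all three parameters
-- lowered by one, so every point has degree at least `c`; then incidences are counted.
schönheim : ∀ {v k t c} → (∀ {𝓑} → Cover v k t 𝓑 → c ≤ length 𝓑) →
            ∀ {𝓑} → Cover (suc v) (suc k) (suc t) 𝓑 → suc v * c ≤ suc k * length 𝓑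
schönheim {v} {k} {c = c} bound {𝓑} cov = begin
  suc v * c                             ≤⟨ sum-tabulate-≥ c≤deg ⟩
  sum (tabulate (λ x → deg 𝓑 (x ∷ [])))  ≡⟨ sum-deg (Cover.sizes cov) [] ⟩
  suc k * deg 𝓑 []                      ≡⟨ cong (suc k *_) (deg-[] 𝓑) ⟩
  suc k * length 𝓑                      ∎
  where
  open ℕ.≤-Reasoning
  c≤deg : ∀ x → c ≤ deg 𝓑 (x ∷ [])
  c≤deg x = begin
    c                       ≤⟨ bound (cover-derived x cov) ⟩
    length (derived x 𝓑)    ≡⟨ deg-[] (derived x 𝓑) ⟨
    deg (derived x 𝓑) []    ≡⟨ deg-derived x 𝓑 [] ⟩
    deg 𝓑 (x ∷ [])          ∎

others : List (Fin n) → List (Fin n)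
others {n} xs = filter (λ i → ¬? (i ∈? xs)) (allFin n)
  where open import Data.List.Membership.DecPropositional (Fin._≟_ {n}) using (_∈?_)

∈-others : ∀ {xs : List (Fin n)} {y} → y ∈ others xs → y ∉ xs
∈-others {n} {xs} y∈ = proj₂ (∈-filter⁻ (λ i → ¬? (i ∈? xs)) {xs = allFin n} y∈)
  where open import Data.List.Membership.DecPropositional (Fin._≟_ {n}) using (_∈?_)

others-∈ : ∀ {xs : List (Fin n)} {y} → y ∉ xs → y ∈ others xs
others-∈ {n} {xs} {y} y∉ = ∈-filter⁺ (λ i → ¬? (i ∈? xs)) (∈-allFin y) y∉
  where open import Data.List.Membership.DecPropositional (Fin._≟_ {n}) using (_∈?_)

others-unique : ∀ (xs : List (Fin n)) → Unique (others xs)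
others-unique {n} xs = Unique.filter⁺ _ (Unique.allFin⁺ n)

others-++-unique : ∀ {xs : List (Fin n)} → Unique xs → Unique (xs ++ others xs)
others-++-unique {xs = xs} u = Unique.++⁺ u (others-unique xs) λ (a , b) → ∈-others b a

others-↭ : ∀ {xs : List (Fin n)} → Unique xs → xs ++ others xs ↭ allFin n
others-↭ {n} {xs} u = ∼bag⇒↭ (unique∧set⇒bag (others-++-unique u) (Unique.allFin⁺ n)
  (mk⇔ (λ _ → ∈-allFin _) (λ _ → mem _)))
  where
  open import Data.List.Membership.DecPropositional (Fin._≟_ {n}) using (_∈?_)
  mem : ∀ y → y ∈ xs ++ others xs
  mem y with y ∈? xs
  ... | yes y∈ = ∈-++⁺ˡ y∈
  ... | no y∉  = ∈-++⁺ʳ xs (others-∈ y∉)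

length-++-others : ∀ {xs : List (Fin n)} → Unique xs → length (xs ++ others xs) ≡ n
length-++-others u = trans (↭-length (others-↭ u)) (length-tabulate id)

length-others : ∀ {xs : List (Fin n)} → Unique xs → length (others xs) ≡ n ∸ length xs
length-others {n} {xs} u = begin
  length (others xs)                             ≡⟨ ℕ.m+n∸m≡n (length xs) _ ⟨
  length xs + length (others xs) ∸ length xs     ≡⟨ cong (_∸ length xs) (length-++ xs) ⟨
  length (xs ++ others xs) ∸ length xs           ≡⟨ cong (_∸ length xs) (length-++-others u) ⟩
  n ∸ length xs                                  ∎
  where open ≡-Reasoning

sum-deg-others : ∀ {𝓑 : List (Subset n)} → All (λ B → ∣ B ∣ ≡ k) 𝓑 → ∀ {zs} xs → Unique zs →
  sum (map (λ w → deg 𝓑 (w ∷ xs)) zs) + sum (map (λ w → deg 𝓑 (w ∷ xs)) (others zs)) ≡ k * deg 𝓑 xs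
sum-deg-others {n} {𝓑 = 𝓑} sz {zs} xs u = begin
  sum (map f zs) + sum (map f (others zs))   ≡⟨ sum-++ (map f zs) _ ⟨
  sum (map f zs ++ map f (others zs))        ≡⟨ cong sum (map-++ f zs (others zs)) ⟨
  sum (map f (zs ++ others zs))              ≡⟨ sum-↭ (map⁺ f (others-↭ u)) ⟩
  sum (map f (allFin n))                     ≡⟨ cong sum (map-tabulate id f) ⟩
  sum (tabulate f)                           ≡⟨ sum-deg sz xs ⟩
  _                                          ∎
  where
  open ≡-Reasoning
  f : Fin n → ℕ
  f w = deg 𝓑 (w ∷ xs)

deg-∈ : ∀ (𝓑 : List (Subset n)) {x xs} → x ∈ xs → deg 𝓑 (x ∷ xs) ≡ deg 𝓑 xs
deg-∈ 𝓑 {x} {xs} x∈ = ℕ.≤-antisym (deg-antitone 𝓑 xs (x ∷ xs) there) (deg-antitone 𝓑 (x ∷ xs) xs λ { (here refl) → x∈ ; (there p) → p })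

-- Started at the empty set this lists the k-subsets on which dual weights are tested; started at a
-- t-set it lists the branches of a search.
supersets : Subset n → ℕ → List (Subset n)
supersets []            zero    = [] ∷ []
supersets []            (suc k) = []
supersets (inside ∷ S)  zero    = []
supersets (inside ∷ S)  (suc k) = map (inside ∷_) (supersets S k)
supersets (outside ∷ S) zero    = map (outside ∷_) (supersets S zero)
supersets (outside ∷ S) (suc k) = map (inside ∷_) (supersets S k) ++ map (outside ∷_) (supersets S (suc k))

∈-supersets : ∀ (S B : Subset n) → (∀ i → lookup S i ≡ true → lookup B i ≡ true) → B ∈ supersets S ∣ B ∣
∈-supersets []            []            S⊆B = here refl
∈-supersets (inside ∷ S)  (inside ∷ B)  S⊆B = ∈-map⁺ (inside ∷_) (∈-supersets S B (S⊆B ∘ suc))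
∈-supersets (inside ∷ S)  (outside ∷ B) S⊆B with () ← S⊆B zero refl
∈-supersets (outside ∷ S) (inside ∷ B)  S⊆B = ∈-++⁺ˡ (∈-map⁺ (inside ∷_) (∈-supersets S B (S⊆B ∘ suc)))
∈-supersets (outside ∷ S) (outside ∷ B) S⊆B with ∣ B ∣ | ∈-supersets S B (S⊆B ∘ suc)
... | zero  | p = ∈-map⁺ (outside ∷_) p
... | suc k | p = ∈-++⁺ʳ (map (inside ∷_) (supersets S k)) (∈-map⁺ (outside ∷_) p)

∈-fromPoints : ∀ (xs : List (Fin n)) {y} → lookup (fromPoints xs) y ≡ true → y ∈ xs
∈-fromPoints []       {y} eq = contradiction (trans (sym eq) (lookup-replicate y outside)) λ ()
∈-fromPoints (x ∷ xs) {y} eq with y Fin.≟ x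
... | yes y≡x = here y≡x
... | no y≢x  = there (∈-fromPoints xs (trans (sym (lookup∘update′ y≢x (fromPoints xs) inside)) eq))

∧-true : ∀ {a b} → a ∧ b ≡ true → a ≡ true × b ≡ true
∧-true {true} p = refl , p

≤ᵇ-true : ∀ {a b} → (a ≤ᵇ b) ≡ true → a ≤ b
≤ᵇ-true {a} p = ℕ.≤ᵇ⇒≤ a _ (Equivalence.from T-≡ p)

does-true : ∀ {A : Set} (d : Dec A) → does d ≡ true → A
does-true (yes a) p = a

all-true : ∀ {A : Set} (p : A → Bool) xs → all p xs ≡ true → All (λ x → p x ≡ true) xs
all-true p []       eq = []
all-true p (x ∷ xs) eq = let a , b = ∧-true eq in a ∷ all-true p xs b

all-intro : ∀ {A : Set} {p : A → Bool} {xs} → All (λ x → p x ≡ true) xs → all p xs ≡ true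
all-intro []       = refl
all-intro (p ∷ ps) = cong₂ _∧_ p (all-intro ps)

any-true : ∀ {A : Set} (p : A → Bool) xs → any p xs ≡ true → ∃ λ x → x ∈ xs × p x ≡ true
any-true p (x ∷ xs) eq with p x in px
... | true  = x , here refl , px
... | false = let y , y∈ , py = any-true p xs eq in y , there y∈ , py

any-false : ∀ {A : Set} (p : A → Bool) xs → any p xs ≡ false → All (λ x → p x ≡ false) xs
any-false p []       eq = []
any-false p (x ∷ xs) eq with p x in px
... | false = px ∷ any-false p xs eq

-- Linear programming duality

-- A term (w , xs , b) stands for w times an inequality between deg xs and b.
Term : ℕ → Set
Term n = ℕ × List (Fin n) × ℕ

weight : List (Term n) → Subset n → ℕ
weight ts B = sum (map (λ (w , xs , _) → w * ⟦ xs ⊑ B ⟧) ts)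

value : List (Term n) → ℕ
value ts = sum (map (λ (w , _ , b) → w * b) ts)

Lower Upper : List (Subset n) → Term n → Set
Lower 𝓑 (_ , xs , b) = b ≤ deg 𝓑 xs
Upper 𝓑 (_ , xs , b) = deg 𝓑 xs ≤ b

private
  total : List (Term n) → List (Subset n) → ℕ
  total ts 𝓑 = sum (map (λ (w , xs , _) → w * deg 𝓑 xs) ts)

  total-[] : ∀ (ts : List (Term n)) → total ts [] ≡ 0
  total-[] []             = refl
  total-[] ((w , _) ∷ ts) = cong₂ _+_ (ℕ.*-zeroʳ w) (total-[] ts)

  total-∷ : ∀ (ts : List (Term n)) B 𝓑 → total ts (B ∷ 𝓑) ≡ weight ts B + total ts 𝓑
  total-∷ []                  B 𝓑 = refl
  total-∷ ((w , xs , _) ∷ ts) B 𝓑 = trans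
    (cong (w * (⟦ xs ⊑ B ⟧ + deg 𝓑 xs) +_) (total-∷ ts B 𝓑))
    (solve 5 (λ w x d p q → w :* (x :+ d) :+ (p :+ q) := w :* x :+ p :+ (w :* d :+ q)) refl
      w ⟦ xs ⊑ B ⟧ (deg 𝓑 xs) (weight ts B) (total ts 𝓑))
    where open +-*-Solver using (solve; _:=_; _:+_; _:*_)

  total-≡ : ∀ (ts : List (Term n)) 𝓑 → total ts 𝓑 ≡ sum (map (weight ts) 𝓑)
  total-≡ ts []      = total-[] ts
  total-≡ ts (B ∷ 𝓑) = trans (total-∷ ts B 𝓑) (cong (weight ts B +_) (total-≡ ts 𝓑))

-- A weighted sum of degrees is the sum over the blocks of their weights, so a comparison at each
-- block carries over to the bounds.
linear-bound : ∀ {𝓑 : List (Subset n)} ds ss → All (Lower 𝓑) ds → All (Upper 𝓑) ss →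
               All (λ B → weight ds B ≤ weight ss B) 𝓑 → value ds ≤ value ss
linear-bound {𝓑 = 𝓑} ds ss lo hi h = begin
  value ds                   ≤⟨ sum-map-mono (All.map (λ {(w , _)} → ℕ.*-monoʳ-≤ w) lo) ⟩
  total ds 𝓑                 ≡⟨ total-≡ ds 𝓑 ⟩
  sum (map (weight ds) 𝓑)    ≤⟨ sum-map-mono h ⟩
  sum (map (weight ss) 𝓑)    ≡⟨ total-≡ ss 𝓑 ⟨
  total ss 𝓑                 ≤⟨ sum-map-mono (All.map (λ {(w , _)} → ℕ.*-monoʳ-≤ w) hi) ⟩
  value ss                   ∎
  where open ℕ.≤-Reasoning

dominated : (Subset n → Bool) → ℕ → List (Term n) → List (Term n) → Bool
dominated {n} shape k ds ss = all (λ B → not (shape B) ∨ (weight ds B ≤ᵇ weight ss B)) (supersets Subset.⊥ k)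

-- Weak duality for the linear program on the multiplicities of the k-subsets of the given shape.
dual-bound : ∀ shape k (ds ss : List (Term n)) → dominated shape k ds ss ≡ true →
             ∀ {𝓑} → All (λ B → ∣ B ∣ ≡ k) 𝓑 → All (λ B → shape B ≡ true) 𝓑 →
             All (Lower 𝓑) ds → All (Upper 𝓑) ss → value ds ≤ value ss
dual-bound {n} shape k ds ss dom sizes shapes lo hi =
  linear-bound ds ss lo hi (All.zipWith (λ {B} (sz , sh) → dom-at B sz sh) (sizes , shapes))
  where
  pick : ∀ {a b} → a ≡ true → not a ∨ b ≡ true → b ≡ true
  pick refl p = p
  dom-at : ∀ B → ∣ B ∣ ≡ k → shape B ≡ true → weight ds B ≤ weight ss B
  dom-at B refl sh = ≤ᵇ-true (pick sh (All.lookup (all-true _ (supersets Subset.⊥ ∣ B ∣) dom)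
    (∈-supersets Subset.⊥ B λ i eq → contradiction (trans (sym eq) (lookup-replicate i outside)) λ ())))

-- Each block of `C` is cut out of `𝓑` where it is found; the later ones differ from it and survive
-- the cut.
deg-⊆ : ∀ {C 𝓑 : List (Subset n)} → Unique C → All (_∈ 𝓑) C → ∀ xs → deg C xs ≤ deg 𝓑 xs
deg-⊆ []        []         xs = z≤n
deg-⊆ {C = K ∷ C} (K∉ ∷ u) (K∈ ∷ C⊆) xs with ∈-∃++ K∈
... | ys , zs , refl = begin
  ⟦ xs ⊑ K ⟧ + deg C xs                      ≤⟨ ℕ.+-monoʳ-≤ ⟦ xs ⊑ K ⟧ (deg-⊆ u (All.zipWith (λ (K≢ , p) → remove K≢ p) (K∉ , C⊆)) xs) ⟩
  ⟦ xs ⊑ K ⟧ + deg (ys ++ zs) xs             ≡⟨ cong (⟦ xs ⊑ K ⟧ +_) (split ys zs) ⟩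
  ⟦ xs ⊑ K ⟧ + (deg ys xs + deg zs xs)       ≡⟨ solve 3 (λ a b c → a :+ (b :+ c) := b :+ (a :+ c)) refl ⟦ xs ⊑ K ⟧ (deg ys xs) (deg zs xs) ⟩
  deg ys xs + deg (K ∷ zs) xs                ≡⟨ split ys (K ∷ zs) ⟨
  deg (ys ++ K ∷ zs) xs                      ∎
  where
  open ℕ.≤-Reasoning
  open +-*-Solver using (solve; _:=_; _:+_; _:*_)
  split : ∀ as bs → deg (as ++ bs) xs ≡ deg as xs + deg bs xs
  split as bs = trans (cong sum (map-++ _ as bs)) (sum-++ (map (λ B → ⟦ xs ⊑ B ⟧) as) (map (λ B → ⟦ xs ⊑ B ⟧) bs))
  remove : ∀ {L} → K ≢ L → L ∈ ys ++ K ∷ zs → L ∈ ys ++ zs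
  remove K≢L L∈ with ∈-++⁻ ys L∈
  ... | inj₁ p          = ∈-++⁺ˡ p
  ... | inj₂ (here eq)  = contradiction (sym eq) K≢L
  ... | inj₂ (there p)  = ∈-++⁺ʳ ys p

-- Exhaustive search with references

Config : ℕ → Set
Config n = List (Subset n)

relabel : Vec (Fin n) n → List (Subset n) → List (Subset n)
relabel ρ = map (pull (lookup ρ))

-- Exhaustive search for the blocks of a cover, up to the relabellings that are admissible.
module Search {n : ℕ}
  (k t : ℕ) (caps : List (List (Fin n) × ℕ))
  (Sat Goal : List (Subset n) → Set)
  (sat-cover : ∀ {𝓑} → Sat 𝓑 → Cover n k t 𝓑)
  (sat-caps  : ∀ {𝓑} → Sat 𝓑 → All (λ (xs , c) → deg 𝓑 xs ≤ c) caps)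
  (admissible : Vec (Fin n) n → Bool)
  (sat-relabel  : ∀ ρ → admissible ρ ≡ true → ∀ {𝓑} → Sat 𝓑 → Sat (relabel ρ 𝓑))
  (goal-relabel : ∀ ρ → admissible ρ ≡ true → ∀ {𝓑} → Goal (relabel ρ 𝓑) → Goal 𝓑)
  where

  Leads : Config n → Set
  Leads C = ∀ {𝓑} → Sat 𝓑 → All (_∈ 𝓑) C → Goal 𝓑

  record Reference : Set where
    constructor _via_
    field
      target : ∃ Leads
      labels : Vec (Fin n) n

  open Reference

  _≡ᵇˢ_ : Subset n → Subset n → Bool
  A ≡ᵇˢ B = does (≡-dec _≟ᵇ_ A B)

  contains : Config n → Config n → Bool
  contains C D = all (λ B → any (B ≡ᵇˢ_) C) D

  matches : Config n → Reference → Bool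
  matches C r = admissible (labels r) ∧ contains (relabel (labels r) C) (proj₁ (target r))

  viable : Config n → Subset n → Bool
  viable C K = all (λ (xs , c) → not (xs ⊑ K) ∨ (deg C xs <ᵇ c)) caps

  -- Branching is on the block that covers the next t-set. A leaf succeeds only through a reference,
  -- so with no references success means that the caps close every branch.
  search : List Reference → List (List (Fin n)) → Config n → Bool
  search refs []       C = any (matches C) refs
  search refs (x ∷ xs) C =
    if any (x ⊑_) C then search refs xs C
    else all (λ K → not (viable C K) ∨ search refs xs (K ∷ C)) (supersets (fromPoints x) k)

  check : Config n → List (List (Fin n)) → List Reference → Bool
  check C xs refs = does (DecUnique.unique? (≡-dec _≟ᵇ_) C)
    ∧ (all (λ x → does (DecUnique.unique? Fin._≟_ x) ∧ does (length x ℕ.≟ t)) xs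
    ∧ search refs xs C)

  contains-sound : ∀ {C} D → contains C D ≡ true → ∀ {𝓑} → All (_∈ 𝓑) C → All (_∈ 𝓑) D
  contains-sound {C} D p C⊆ = All.map
    (λ {B} q → let B′ , B′∈ , eq = any-true (B ≡ᵇˢ_) C q in
      subst (_∈ _) (sym (does-true (≡-dec _≟ᵇ_ B B′) eq)) (All.lookup C⊆ B′∈))
    (all-true _ D p)

  refer : ∀ r {C} → matches C r ≡ true → Leads C
  refer ((D , leads) via ρ) {C} p sat C⊆ =
    let adm , c = ∧-true p in
    goal-relabel ρ adm (leads (sat-relabel ρ adm sat)
      (contains-sound D c (All.map⁺ (All.map (∈-map⁺ (pull (lookup ρ))) C⊆))))

  -- A block of a true solution is never pruned: together with the chosen blocks it forms a list of
  -- distinct members of `𝓑`, whose degrees respect the caps.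
  viable-sound : ∀ {C K 𝓑} → Sat 𝓑 → Unique (K ∷ C) → All (_∈ 𝓑) (K ∷ C) → viable C K ≡ true
  viable-sound {C} {K} {𝓑} sat u ⊆𝓑 =
    all-intro (All.map (λ {(xs , c)} le → room (xs ⊑ K) (deg C xs) (ℕ.≤-trans (deg-⊆ u ⊆𝓑 xs) le)) (sat-caps sat))
    where
    room : ∀ b d {c} → ⟦ b ⟧ + d ≤ c → not b ∨ (d <ᵇ c) ≡ true
    room false d _ = refl
    room true  d p = Equivalence.to T-≡ (ℕ.<⇒<ᵇ p)

  search-sound : ∀ refs xs {C} → All (λ x → Unique x × length x ≡ t) xs → search refs xs C ≡ true →
                 Unique C → Leads C
  search-sound refs [] {C} [] p u = let r , _ , m = any-true (matches C) refs p in refer r m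
  search-sound refs (x ∷ xs) {C} ((ux , lx) ∷ vs) p u sat C⊆ with any (x ⊑_) C in eq
  ... | true  = search-sound refs xs vs p u sat C⊆
  ... | false with deg⇒Any (sat-cover sat .Cover.covers x ux lx)
    where
    deg⇒Any : ∀ {𝓑} → 1 ≤ deg 𝓑 x → ∃ λ K → K ∈ 𝓑 × x ⊑ K ≡ true
    deg⇒Any {B ∷ 𝓑} h with x ⊑ B in e
    ... | true  = B , here refl , e
    ... | false = let K , K∈ , e′ = deg⇒Any {𝓑} h in K , there K∈ , e′
  ...   | K , K∈ , x⊑K = search-sound refs xs vs
    (pick (viable-sound sat uK (K∈ ∷ C⊆)) (All.lookup (all-true _ (supersets (fromPoints x) k) p) K∈supersets)) uK sat (K∈ ∷ C⊆)
    where
    K∈supersets : K ∈ supersets (fromPoints x) k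
    K∈supersets = subst (λ j → K ∈ supersets (fromPoints x) j) (All.lookup (sat-cover sat .Cover.sizes) K∈)
      (∈-supersets (fromPoints x) K λ i eq → ⊑⇒∈ K x x⊑K (∈-fromPoints x eq))
    -- `K` contains `x` and no block of `C` does, so `K` is new.
    uK : Unique (K ∷ C)
    uK = All.map (λ { {L} nx refl → contradiction (trans (sym x⊑K) nx) λ () }) (any-false (x ⊑_) C eq) ∷ u
    pick : ∀ {b c} → b ≡ true → not b ∨ c ≡ true → c ≡ true
    pick refl q = q

  explore : ∀ C xs refs → check C xs refs ≡ true → Leads C
  explore C xs refs p =
    let a , q = ∧-true p
        b , s = ∧-true q
    in search-sound refs xs
         (All.map (λ {x} v → let c , d = ∧-true v in does-true (DecUnique.unique? Fin._≟_ x) c , does-true (length x ℕ.≟ t) d)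
           (all-true _ xs b))
         s (does-true (DecUnique.unique? (≡-dec _≟ᵇ_) C) a)

-- Refined double counting

flags : ∀ {𝓑 : List (Subset n)} → All (λ B → ∣ B ∣ ≡ k) 𝓑 → ∀ ys xs → Unique (ys ++ xs) → length xs ≤ k →
  sum (map (λ w → deg 𝓑 (w ∷ xs)) ys) + sum (map (λ w → deg 𝓑 (w ∷ xs)) (others (ys ++ xs))) ≡ (k ∸ length xs) * deg 𝓑 xs
flags {n} {k} {𝓑} sz ys xs u m≤k = ℕ.+-cancelˡ-≡ (length xs * d) _ _ (begin
  length xs * d + (sum (map f ys) + rest)          ≡⟨ cong (_+ (sum (map f ys) + rest)) (inner xs id) ⟨
  sum (map f xs) + (sum (map f ys) + rest)         ≡⟨ solve 3 (λ a b c → a :+ (b :+ c) := b :+ a :+ c) refl (sum (map f xs)) (sum (map f ys)) rest ⟩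
  sum (map f ys) + sum (map f xs) + rest           ≡⟨ cong (_+ rest) (trans (cong sum (map-++ f ys xs)) (sum-++ (map f ys) (map f xs))) ⟨
  sum (map f (ys ++ xs)) + rest                    ≡⟨ sum-deg-others sz xs u ⟩
  k * d                                            ≡⟨ cong (_* d) (ℕ.m+[n∸m]≡n m≤k) ⟨
  (length xs + (k ∸ length xs)) * d                ≡⟨ ℕ.*-distribʳ-+ d (length xs) _ ⟩
  length xs * d + (k ∸ length xs) * d              ∎)
  where
  open ≡-Reasoning
  open +-*-Solver using (solve; _:=_; _:+_)
  f : Fin n → ℕ
  f w = deg 𝓑 (w ∷ xs)
  d rest : ℕ
  d = deg 𝓑 xs
  rest = sum (map f (others (ys ++ xs)))
  -- Each point of `xs` contributes the full degree to the count of flags; these terms are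
  -- cancelled.
  inner : ∀ zs → (∀ {z} → z ∈ zs → z ∈ xs) → sum (map f zs) ≡ length zs * d
  inner []       s = refl
  inner (z ∷ zs) s = cong₂ _+_ (deg-∈ 𝓑 (s (here refl))) (inner zs (s ∘ there))

sum-map-≥ : ∀ {A : Set} {f : A → ℕ} {c xs} → All (λ x → c ≤ f x) xs → length xs * c ≤ sum (map f xs)
sum-map-≥ []       = z≤n
sum-map-≥ (p ∷ ps) = ℕ.+-mono-≤ p (sum-map-≥ ps)

sum-map-≤ : ∀ {A : Set} {f : A → ℕ} {c xs} → All (λ x → f x ≤ c) xs → sum (map f xs) ≤ length xs * c
sum-map-≤ []       = z≤n
sum-map-≤ (p ∷ ps) = ℕ.+-mono-≤ p (sum-map-≤ ps)

-- An exceptional term falls short of `suc c` by exactly one, since no term is below `c`.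
sum-map-exceptions : ∀ {A : Set} (f : A → ℕ) c xs → All (λ x → c ≤ f x) xs →
  length xs * suc c ≤ sum (map f xs) + length (filter (λ x → f x ℕ.≤? c) xs)
sum-map-exceptions f c []       []       = z≤n
sum-map-exceptions {A} f c (x ∷ xs) (p ∷ ps) = by-cases (f x ℕ.≤? c)
  where
  open ℕ.≤-Reasoning
  open +-*-Solver using (solve; _:=_; _:+_; con)
  small? : (x : A) → Dec (f x ≤ c)
  small? x = f x ℕ.≤? c
  e : ℕ
  e = length (filter small? xs)
  by-cases : Dec (f x ≤ c) → suc (length xs) * suc c ≤ sum (map f (x ∷ xs)) + length (filter small? (x ∷ xs))
  by-cases (yes q) = begin
    suc c + length xs * suc c                                   ≤⟨ ℕ.+-mono-≤ (s≤s p) (sum-map-exceptions f c xs ps) ⟩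
    suc (f x) + (sum (map f xs) + e)                            ≡⟨ solve 3 (λ a b c → con 1 :+ a :+ (b :+ c) := a :+ b :+ (con 1 :+ c)) refl (f x) (sum (map f xs)) e ⟩
    f x + sum (map f xs) + suc e                                ≡⟨ cong (λ l → f x + sum (map f xs) + length l) (filter-accept small? q) ⟨
    f x + sum (map f xs) + length (filter small? (x ∷ xs))      ∎
  by-cases (no ¬q) = begin
    suc c + length xs * suc c                                   ≤⟨ ℕ.+-mono-≤ (ℕ.≰⇒> ¬q) (sum-map-exceptions f c xs ps) ⟩
    f x + (sum (map f xs) + e)                                  ≡⟨ ℕ.+-assoc (f x) _ _ ⟨
    f x + sum (map f xs) + e                                    ≡⟨ cong (λ l → f x + sum (map f xs) + length l) (filter-reject small? ¬q) ⟨
    f x + sum (map f xs) + length (filter small? (x ∷ xs))      ∎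

labels : ∀ (L : List (Fin n)) → .(length L ≡ k) → Vec (Fin n) k
labels L eq = Vec.cast eq (Vec.fromList L)

labels-∈ : ∀ (L : List (Fin n)) .(eq : length L ≡ k) i → lookup (labels L eq) i ∈ L
labels-∈ {k = suc k} (x ∷ L) eq zero    = here refl
labels-∈ {k = suc k} (x ∷ L) eq (suc i) = there (labels-∈ L (ℕ.suc-injective eq) i)

labels-injective : ∀ {L : List (Fin n)} .(eq : length L ≡ k) → Unique L → Injective _≡_ _≡_ (lookup (labels L eq))
labels-injective {k = suc k} {x ∷ L} eq (p ∷ u) {zero}  {zero}  _ = refl
labels-injective {k = suc k} {x ∷ L} eq (p ∷ u) {zero}  {suc j} e = contradiction e (All.lookup p (labels-∈ L (ℕ.suc-injective eq) j))
labels-injective {k = suc k} {x ∷ L} eq (p ∷ u) {suc i} {zero}  e = contradiction (sym e) (All.lookup p (labels-∈ L (ℕ.suc-injective eq) i))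
labels-injective {k = suc k} {x ∷ L} eq (p ∷ u) {suc i} {suc j} e = cong suc (labels-injective (ℕ.suc-injective eq) u e)

-- Degrees in a (12,6,4) covering

Point : Set
Point = Fin 12

points : List ℕ → List Point
points = map (_mod 12)

unique? : (xs : List Point) → Dec (Unique xs)
unique? = DecUnique.unique? Fin._≟_

∉⇒≢ : ∀ {x : Fin n} {xs} → x ∉ xs → All (x ≢_) xs
∉⇒≢ x∉ = All.tabulate λ y∈ eq → x∉ (subst (_∈ _) (sym eq) y∈)

others-fresh : ∀ {xs : List (Fin n)} → Unique xs → All (λ w → Unique (w ∷ xs)) (others xs)
others-fresh u = All.tabulate λ w∈ → ∉⇒≢ (∈-others w∈) ∷ u

Tripled : List (Subset 12) → List Point → Set
Tripled 𝓑 zs = All (λ z → deg 𝓑 (z ∷ # 0 ∷ # 1 ∷ []) ≤ 3) zs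

-- The three blocks through a triple of degree 3 partition the other nine points.
tightCaps : List Point → List (List Point × ℕ)
tightCaps zs = map (λ z → (z ∷ # 0 ∷ # 1 ∷ [] , 3)) zs
  ++ concatMap (λ z → map (λ w → (w ∷ z ∷ # 0 ∷ # 1 ∷ [] , 1)) (others (z ∷ # 0 ∷ # 1 ∷ []))) zs

module _ {𝓑 : List (Subset 12)} (cov : Cover 12 6 4 𝓑) where
  open Cover cov

  deg₄-≥ : ∀ {w x y z} → Unique (w ∷ x ∷ y ∷ z ∷ []) → 1 ≤ deg 𝓑 (w ∷ x ∷ y ∷ z ∷ [])
  deg₄-≥ u = covers _ u refl

  -- Nine points remain, and each block through the triple holds three of them.
  deg₃-≥ : ∀ {x y z} → Unique (x ∷ y ∷ z ∷ []) → 3 ≤ deg 𝓑 (x ∷ y ∷ z ∷ [])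
  deg₃-≥ {x} {y} {z} u = ℕ.*-cancelˡ-≤ 3 (begin
    9                                                    ≡⟨ cong (_* 1) (length-others u) ⟨
    length (others (x ∷ y ∷ z ∷ [])) * 1                 ≤⟨ sum-map-≥ (All.map deg₄-≥ (others-fresh u)) ⟩
    sum (map (λ w → deg 𝓑 (w ∷ x ∷ y ∷ z ∷ [])) (others (x ∷ y ∷ z ∷ []))) ≡⟨ flags sizes [] (x ∷ y ∷ z ∷ []) u (s≤s (s≤s (s≤s z≤n))) ⟩
    3 * deg 𝓑 (x ∷ y ∷ z ∷ [])                           ∎)
    where open ℕ.≤-Reasoning

  -- The other eight points already use eight of the nine incidences.
  deg₄-≤ : ∀ {w x y z} → Unique (w ∷ x ∷ y ∷ z ∷ []) → deg 𝓑 (x ∷ y ∷ z ∷ []) ≤ 3 → deg 𝓑 (w ∷ x ∷ y ∷ z ∷ []) ≤ 1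
  deg₄-≤ {w} {x} {y} {z} u@(_ ∷ u₃) le = ℕ.+-cancelʳ-≤ 8 _ _ (begin
    deg 𝓑 (w ∷ x ∷ y ∷ z ∷ []) + 8                       ≡⟨ cong₂ _+_ (sym (ℕ.+-identityʳ _)) (cong (_* 1) (sym (length-others u))) ⟩
    deg 𝓑 (w ∷ x ∷ y ∷ z ∷ []) + 0 + length (others (w ∷ x ∷ y ∷ z ∷ [])) * 1
      ≤⟨ ℕ.+-monoʳ-≤ _ (sum-map-≥ (All.map (λ {v} → λ { ((_ ∷ p) ∷ _ ∷ q) → deg₄-≥ (p ∷ q) }) (others-fresh u))) ⟩
    deg 𝓑 (w ∷ x ∷ y ∷ z ∷ []) + 0 + sum (map (λ v → deg 𝓑 (v ∷ x ∷ y ∷ z ∷ [])) (others (w ∷ x ∷ y ∷ z ∷ [])))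
      ≡⟨ flags sizes (w ∷ []) (x ∷ y ∷ z ∷ []) u (s≤s (s≤s (s≤s z≤n))) ⟩
    3 * deg 𝓑 (x ∷ y ∷ z ∷ [])                           ≤⟨ ℕ.*-monoʳ-≤ 3 le ⟩
    9                                                    ∎)
    where open ℕ.≤-Reasoning

  tightCaps-sound : ∀ zs → All (λ z → Unique (z ∷ # 0 ∷ # 1 ∷ [])) zs → Tripled 𝓑 zs →
                    All (λ (xs , c) → deg 𝓑 xs ≤ c) (tightCaps zs)
  tightCaps-sound zs us tr = All.++⁺ (All.map⁺ tr) (All.concat⁺ (All.map⁺
    (All.zipWith (λ {z} (u , le) → All.map⁺ (All.map (λ v → deg₄-≤ v le) (others-fresh u))) (us , tr))))

labelled : ∀ {𝓑 : List (Subset 12)} L (eq : length L ≡ 12) → Unique L → Cover 12 6 4 𝓑 → Cover 12 6 4 (relabel (labels L eq) 𝓑)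
labelled L eq u = cover-relabel (labels-injective {L = L} eq u)

pairsThrough : List Point → List (List Point)
pairsThrough []       = []
pairsThrough (a ∷ as) = map (λ b → # 0 ∷ # 1 ∷ a ∷ b ∷ []) as ++ pairsThrough as

module Five where

  zs : List Point
  zs = points (2 ∷ 3 ∷ 4 ∷ 5 ∷ 6 ∷ [])

  open Search 6 4 (tightCaps zs) (λ 𝓑 → Cover 12 6 4 𝓑 × Tripled 𝓑 zs) (λ _ → ⊥) proj₁
    (λ (cov , tr) → tightCaps-sound cov zs (toWitness {a? = All.all? (λ z → unique? (z ∷ # 0 ∷ # 1 ∷ [])) zs} _) tr)
    (λ _ → false) (λ _ ()) (λ _ ())

  abstract
    impossible : Leads []
    -- Pairs that meet `zs` come first, since only they are subject to the caps.
    impossible = explore [] (pairsThrough (zs ++ points (7 ∷ 8 ∷ 9 ∷ 10 ∷ 11 ∷ []))) [] refl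

-- In the notation of designs: a (10,4,2) covering has at most four points of degree 3.
few-triples : ∀ {𝓑} → Cover 12 6 4 𝓑 → ∀ {x y} zs →
              Unique (x ∷ y ∷ zs) → All (λ z → deg 𝓑 (z ∷ x ∷ y ∷ []) ≤ 3) zs → length zs ≤ 4
few-triples cov []                  u tr = z≤n
few-triples cov (_ ∷ [])            u tr = s≤s z≤n
few-triples cov (_ ∷ _ ∷ [])        u tr = s≤s (s≤s z≤n)
few-triples cov (_ ∷ _ ∷ _ ∷ [])    u tr = s≤s (s≤s (s≤s z≤n))
few-triples cov (_ ∷ _ ∷ _ ∷ _ ∷ []) u tr = s≤s (s≤s (s≤s (s≤s z≤n)))
few-triples {𝓑} cov {x} {y} zs@(a ∷ b ∷ c ∷ d ∷ e ∷ _) u (ta ∷ tb ∷ tc ∷ td ∷ te ∷ _) =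
  ⊥-elim (Five.impossible (labelled L eq (others-++-unique u) cov , go (# 2) ta ∷ go (# 3) tb ∷ go (# 4) tc ∷ go (# 5) td ∷ go (# 6) te ∷ []) [])
  where
  L : List Point
  L = (x ∷ y ∷ zs) ++ others (x ∷ y ∷ zs)
  eq : length L ≡ 12
  eq = length-++-others u
  go : ∀ z → deg 𝓑 (map (lookup (labels L eq)) (z ∷ # 0 ∷ # 1 ∷ [])) ≤ 3 → deg (relabel (labels L eq) 𝓑) (z ∷ # 0 ∷ # 1 ∷ []) ≤ 3
  go z = subst (_≤ 3) (sym (deg-pull (lookup (labels L eq)) 𝓑 (z ∷ # 0 ∷ # 1 ∷ [])))

deg-↭ : ∀ (𝓑 : List (Subset n)) xs ys → xs ↭ ys → deg 𝓑 xs ≡ deg 𝓑 ys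
deg-↭ 𝓑 xs ys p = ℕ.≤-antisym (deg-antitone 𝓑 ys xs (∈-resp-↭ (↭.↭-sym p))) (deg-antitone 𝓑 xs ys (∈-resp-↭ p))

fresh-map : ∀ {xs : List (Fin n)} {P : Fin n → Set} → Unique xs → (∀ {w} → Unique (w ∷ xs) → P w) → All P (others xs)
fresh-map u f = All.map f (others-fresh u)

module _ {𝓑 : List (Subset 12)} (cov : Cover 12 6 4 𝓑) where
  open Cover cov

  exceptions : ∀ x y ys → Unique (x ∷ y ∷ ys) → length (filter (λ z → deg 𝓑 (z ∷ x ∷ y ∷ []) ℕ.≤? 3) ys) ≤ 4
  exceptions x y ys ((x≢y ∷ x∉) ∷ y∉ ∷ u) = few-triples cov _
    ((x≢y ∷ All.filter⁺ _ x∉) ∷ All.filter⁺ _ y∉ ∷ Unique.filter⁺ _ u) (All.all-filter _ ys)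

  -- The ten further points contribute at least 4 each, with at most four exceptions of 3: at least
  -- 36 = 4 · 9.
  deg₂-≥ : ∀ {x y} → Unique (x ∷ y ∷ []) → 9 ≤ deg 𝓑 (x ∷ y ∷ [])
  deg₂-≥ {x} {y} u = ℕ.*-cancelˡ-≤ 4 (ℕ.+-cancelʳ-≤ 4 _ _ (begin
    40                                      ≡⟨ cong (_* 4) (length-others u) ⟨
    length O * 4                            ≤⟨ sum-map-exceptions f 3 O (fresh-map u (deg₃-≥ cov)) ⟩
    sum (map f O) + length (filter (λ z → f z ℕ.≤? 3) O)
                                            ≤⟨ ℕ.+-monoʳ-≤ (sum (map f O)) (exceptions x y O (others-++-unique u)) ⟩
    sum (map f O) + 4                       ≡⟨ cong (_+ 4) (flags sizes [] (x ∷ y ∷ []) u (s≤s (s≤s z≤n))) ⟩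
    4 * deg 𝓑 (x ∷ y ∷ []) + 4              ∎))
    where
    open ℕ.≤-Reasoning
    O : List Point
    O = others (x ∷ y ∷ [])
    f : Point → ℕ
    f z = deg 𝓑 (z ∷ x ∷ y ∷ [])

  -- Eleven pairs of degree at least 9 give 99 incidences, more than 5 · 19.
  deg₁-≥ : ∀ x → 20 ≤ deg 𝓑 (x ∷ [])
  deg₁-≥ x = ℕ.*-cancelˡ-< 5 19 _ (begin-strict
    95                                                 <⟨ ℕ.m≤m+n 96 3 ⟩
    99                                                 ≡⟨ cong (_* 9) (length-others u) ⟨
    length (others (x ∷ [])) * 9                       ≤⟨ sum-map-≥ (fresh-map u deg₂-≥) ⟩
    sum (map (λ y → deg 𝓑 (y ∷ x ∷ [])) (others (x ∷ []))) ≡⟨ flags sizes [] (x ∷ []) u (s≤s z≤n) ⟩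
    5 * deg 𝓑 (x ∷ [])                                 ∎)
    where
    open ℕ.≤-Reasoning
    u : Unique (x ∷ [])
    u = [] ∷ []

-- Coverings with at most forty blocks

record Tight (𝓑 : List (Subset 12)) : Set where
  field
    cover : Cover 12 6 4 𝓑
    few   : length 𝓑 ≤ 40

module _ {𝓑 : List (Subset 12)} (tight : Tight 𝓑) where
  open Tight tight
  open Cover cover

  -- The other eleven points take at least 220 of the at most 240 incidences.
  deg₁-≤ : ∀ x → deg 𝓑 (x ∷ []) ≤ 20
  deg₁-≤ x = ℕ.+-cancelʳ-≤ 220 _ _ (begin
    deg 𝓑 (x ∷ []) + 220                                       ≡⟨ cong₂ _+_ (sym (ℕ.+-identityʳ _)) (cong (_* 20) (sym (length-others u))) ⟩
    deg 𝓑 (x ∷ []) + 0 + length (others (x ∷ [])) * 20         ≤⟨ ℕ.+-monoʳ-≤ (deg 𝓑 (x ∷ []) + 0) (sum-map-≥ (All.universal (deg₁-≥ cover) (others (x ∷ [])))) ⟩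
    deg 𝓑 (x ∷ []) + 0 + sum (map (λ y → deg 𝓑 (y ∷ [])) (others (x ∷ []))) ≡⟨ flags sizes (x ∷ []) [] u z≤n ⟩
    6 * deg 𝓑 []                                               ≡⟨ cong (6 *_) (deg-[] 𝓑) ⟩
    6 * length 𝓑                                               ≤⟨ ℕ.*-monoʳ-≤ 6 few ⟩
    240                                                        ∎)
    where
    open ℕ.≤-Reasoning
    u : Unique (x ∷ [])
    u = [] ∷ []

  degrees-≤ : ∀ ys x → Unique (ys ++ x ∷ []) → sum (map (λ y → deg 𝓑 (y ∷ x ∷ [])) ys) + length (others (ys ++ x ∷ [])) * 9 ≤ 100
  degrees-≤ ys x u = begin
    sum (map f ys) + length O * 9          ≤⟨ ℕ.+-monoʳ-≤ (sum (map f ys)) (sum-map-≥ (fresh-map u λ v → deg₂-≥ cover (pair v))) ⟩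
    sum (map f ys) + sum (map f O)         ≡⟨ flags sizes ys (x ∷ []) u (s≤s z≤n) ⟩
    5 * deg 𝓑 (x ∷ [])                     ≤⟨ ℕ.*-monoʳ-≤ 5 (deg₁-≤ x) ⟩
    100                                    ∎
    where
    open ℕ.≤-Reasoning
    O : List Point
    O = others (ys ++ x ∷ [])
    f : Point → ℕ
    f y = deg 𝓑 (y ∷ x ∷ [])
    pair : ∀ {w} → Unique (w ∷ ys ++ x ∷ []) → Unique (w ∷ x ∷ [])
    pair (p ∷ _) = (All.lookup p (∈-++⁺ʳ ys (here refl)) ∷ []) ∷ [] ∷ []

  -- The degrees of the eleven pairs through a point add up to 100, one more than 11 · 9, so exactly
  -- one of them is 10.
  Mates : Point → Point → Set
  Mates x y = 10 ≤ deg 𝓑 (y ∷ x ∷ [])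

  -- Two pairs of degree 10 and nine of degree 9 would already give 101.
  mates-unique : ∀ {x y z} → Unique (z ∷ y ∷ x ∷ []) → Mates x y → ¬ Mates x z
  mates-unique {x} {y} {z} u p q = ℕ.<⇒≱ (ℕ.≤-refl {101}) (begin
    101                                                                ≡⟨ cong (λ l → 20 + l * 9) (length-others u) ⟨
    20 + length (others (z ∷ y ∷ x ∷ [])) * 9                          ≤⟨ ℕ.+-monoˡ-≤ _ (ℕ.+-mono-≤ q (ℕ.+-mono-≤ p z≤n)) ⟩
    sum (map (λ w → deg 𝓑 (w ∷ x ∷ [])) (z ∷ y ∷ [])) + length (others (z ∷ y ∷ x ∷ [])) * 9 ≤⟨ degrees-≤ (z ∷ y ∷ []) x u ⟩
    100                                                                ∎)
    where open ℕ.≤-Reasoning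

  mate : ∀ x → ∃ λ y → Unique (y ∷ x ∷ []) × Mates x y
  mate x with Any.any? (λ y → 10 ℕ.≤? deg 𝓑 (y ∷ x ∷ [])) (others (x ∷ []))
  ... | yes a = let y , y∈ , p = find a in y , All.lookup (others-fresh u) y∈ , p
    where
    u : Unique (x ∷ [])
    u = [] ∷ []
  ... | no ¬a = contradiction (begin
    100                                    ≤⟨ ℕ.*-monoʳ-≤ 5 (deg₁-≥ cover x) ⟩
    5 * deg 𝓑 (x ∷ [])                     ≡⟨ flags sizes [] (x ∷ []) u (s≤s z≤n) ⟨
    sum (map f (others (x ∷ [])))          ≤⟨ sum-map-≤ (All.map (ℕ.≤-pred ∘ ℕ.≰⇒>) (All.¬Any⇒All¬ _ ¬a)) ⟩
    length (others (x ∷ [])) * 9           ≡⟨ cong (_* 9) (length-others u) ⟩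
    99                                     ∎) (ℕ.<⇒≱ (ℕ.≤-refl {100}))
    where
    open ℕ.≤-Reasoning
    u : Unique (x ∷ [])
    u = [] ∷ []
    f : Point → ℕ
    f y = deg 𝓑 (y ∷ x ∷ [])

  -- Of the at most 36 incidences, the nine points other than `z` take at least 9 · 4 - 4 = 32.
  deg₃-≤-aux : ∀ {x y z} → Unique (z ∷ x ∷ y ∷ []) → deg 𝓑 (x ∷ y ∷ []) ≤ 9 → deg 𝓑 (z ∷ x ∷ y ∷ []) ≤ 4
  deg₃-≤-aux {x} {y} {z} u@(z∉ ∷ u₂) le = ℕ.+-cancelʳ-≤ 36 _ _ (begin
    f z + 36                                  ≡⟨ cong₂ _+_ (sym (ℕ.+-identityʳ _)) (cong (_* 4) (sym (length-others u))) ⟩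
    f z + 0 + length O * 4                    ≤⟨ ℕ.+-monoʳ-≤ (f z + 0) (sum-map-exceptions f 3 O (fresh-map u λ { ((_ ∷ p) ∷ _ ∷ q) → deg₃-≥ cover (p ∷ q) })) ⟩
    f z + 0 + (sum (map f O) + _)             ≤⟨ ℕ.+-monoʳ-≤ (f z + 0) (ℕ.+-monoʳ-≤ (sum (map f O)) (exceptions cover x y O (AllPairs.tail (others-++-unique u)))) ⟩
    f z + 0 + (sum (map f O) + 4)             ≡⟨ ℕ.+-assoc (f z + 0) (sum (map f O)) 4 ⟨
    f z + 0 + sum (map f O) + 4               ≡⟨ cong (_+ 4) (flags sizes (z ∷ []) (x ∷ y ∷ []) u (s≤s (s≤s z≤n))) ⟩
    4 * deg 𝓑 (x ∷ y ∷ []) + 4                ≤⟨ ℕ.+-monoˡ-≤ 4 (ℕ.*-monoʳ-≤ 4 le) ⟩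
    40                                        ∎)
    where
    open ℕ.≤-Reasoning
    O : List Point
    O = others (z ∷ x ∷ y ∷ [])
    f : Point → ℕ
    f w = deg 𝓑 (w ∷ x ∷ y ∷ [])

  -- If `x` and `y` are mates then `y` and `z` are not, so every triple contains a pair of degree at
  -- most 9.
  deg₃-≤ : ∀ {x y z} → Unique (z ∷ x ∷ y ∷ []) → deg 𝓑 (z ∷ x ∷ y ∷ []) ≤ 4
  deg₃-≤ {x} {y} {z} u@((z≢x ∷ z≢y ∷ []) ∷ (x≢y ∷ []) ∷ [] ∷ []) with deg 𝓑 (x ∷ y ∷ []) ℕ.≤? 9
  ... | yes le = deg₃-≤-aux u le
  ... | no ¬le = subst (_≤ 4) (deg-↭ 𝓑 (x ∷ z ∷ y ∷ []) (z ∷ x ∷ y ∷ []) (↭.↭-swap x z ↭.↭-refl))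
    (deg₃-≤-aux ((≢-sym z≢x ∷ x≢y ∷ []) ∷ (z≢y ∷ []) ∷ [] ∷ [])
      (ℕ.≤-pred (ℕ.≰⇒> (mates-unique u (ℕ.≰⇒> ¬le)))))

  -- Ten points of degree at most 4 have to reach the total 4 · 10, so all attain 4.
  deg₃-mates-≥ : ∀ {x y z} → Unique (z ∷ x ∷ y ∷ []) → Mates y x → 4 ≤ deg 𝓑 (z ∷ x ∷ y ∷ [])
  deg₃-mates-≥ {x} {y} {z} u p = ℕ.+-cancelʳ-≤ 36 _ _ (begin
    40                                        ≤⟨ ℕ.*-monoʳ-≤ 4 p ⟩
    4 * deg 𝓑 (x ∷ y ∷ [])                    ≡⟨ flags sizes (z ∷ []) (x ∷ y ∷ []) u (s≤s (s≤s z≤n)) ⟨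
    f z + 0 + sum (map f O)                   ≤⟨ ℕ.+-monoʳ-≤ (f z + 0) (sum-map-≤ (fresh-map u λ { ((_ ∷ p) ∷ _ ∷ q) → deg₃-≤ (p ∷ q) })) ⟩
    f z + 0 + length O * 4                    ≡⟨ cong₂ _+_ (ℕ.+-identityʳ _) (cong (_* 4) (length-others u)) ⟩
    f z + 36                                  ∎)
    where
    open ℕ.≤-Reasoning
    O : List Point
    O = others (z ∷ x ∷ y ∷ [])
    f : Point → ℕ
    f w = deg 𝓑 (w ∷ x ∷ y ∷ [])

  exactly-four : ∀ {x y} → Unique (x ∷ y ∷ []) → deg 𝓑 (x ∷ y ∷ []) ≤ 9 →
                 length (filter (λ z → deg 𝓑 (z ∷ x ∷ y ∷ []) ℕ.≤? 3) (others (x ∷ y ∷ []))) ≡ 4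
  exactly-four {x} {y} u le = ℕ.≤-antisym (exceptions cover x y O (others-++-unique u)) (ℕ.+-cancelˡ-≤ 36 _ _ (begin
    40                                        ≡⟨ cong (_* 4) (length-others u) ⟨
    length O * 4                              ≤⟨ sum-map-exceptions f 3 O (fresh-map u (deg₃-≥ cover)) ⟩
    sum (map f O) + e                         ≡⟨ cong (_+ e) (flags sizes [] (x ∷ y ∷ []) u (s≤s (s≤s z≤n))) ⟩
    4 * deg 𝓑 (x ∷ y ∷ []) + e                ≤⟨ ℕ.+-monoˡ-≤ e (ℕ.*-monoʳ-≤ 4 le) ⟩
    36 + e                                    ∎))
    where
    open ℕ.≤-Reasoning
    O : List Point
    O = others (x ∷ y ∷ [])
    f : Point → ℕ
    f w = deg 𝓑 (w ∷ x ∷ y ∷ [])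
    e : ℕ
    e = length (filter (λ z → f z ℕ.≤? 3) O)

-- Two points that are not mates

S Z : List Point
S = points (2 ∷ 3 ∷ 4 ∷ 5 ∷ 6 ∷ 7 ∷ [])
Z = points (8 ∷ 9 ∷ 10 ∷ 11 ∷ [])

-- Two points 0 and 1 that are not mates; Z consists of the points that lie with them in three blocks only.
record Marked (𝓑 : List (Subset 12)) : Set where
  field
    tight   : Tight 𝓑
    deg₀₁   : deg 𝓑 (# 0 ∷ # 1 ∷ []) ≤ 9
    tripled : Tripled 𝓑 Z

open Marked

-- Triples have degree at most 4, so this forces every block through the two points and one of their
-- mates to contain the other mate.
Linked : List (Subset 12) → Point → Point → Set
Linked 𝓑 x y = ∃ λ p → ∃ λ q → Unique (p ∷ q ∷ x ∷ y ∷ []) ×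
  10 ≤ deg 𝓑 (p ∷ x ∷ []) × 10 ≤ deg 𝓑 (q ∷ y ∷ []) × 4 ≤ deg 𝓑 (p ∷ q ∷ x ∷ y ∷ [])

linked-pull : ∀ {π : Point → Point} → Injective _≡_ _≡_ π → ∀ {𝓑 x y} → Linked (map (pull π) 𝓑) x y → Linked 𝓑 (π x) (π y)
linked-pull {π} inj {𝓑} {x} {y} (p , q , u , a , b , c) = π p , π q , Unique.map⁺ inj u ,
  subst (10 ≤_) (deg-pull π 𝓑 (p ∷ x ∷ [])) a , subst (10 ≤_) (deg-pull π 𝓑 (q ∷ y ∷ [])) b ,
  subst (4 ≤_) (deg-pull π 𝓑 (p ∷ q ∷ x ∷ y ∷ [])) c

tight-relabel : ∀ {π : Point → Point} → Injective _≡_ _≡_ π → ∀ {𝓑} → Tight 𝓑 → Tight (map (pull π) 𝓑)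
tight-relabel {π} inj {𝓑} t = record
  { cover = cover-relabel inj (Tight.cover t)
  ; few   = subst (_≤ 40) (sym (length-map (pull π) 𝓑)) (Tight.few t)
  }

injective? : ∀ (π : Fin n → Fin n) → Dec (∀ i j → π i ≡ π j → i ≡ j)
injective? π = Fin.all? λ i → Fin.all? λ j → (π i Fin.≟ π j) →-dec (i Fin.≟ j)

Fixing : Vec Point 12 → Set
Fixing ρ = (∀ i j → lookup ρ i ≡ lookup ρ j → i ≡ j) × lookup ρ (# 0) ≡ # 0 × lookup ρ (# 1) ≡ # 1 × All (λ z → lookup ρ z ∈ Z) Z

fixing? : ∀ ρ → Dec (Fixing ρ)
fixing? ρ = injective? (lookup ρ) ×-dec lookup ρ (# 0) Fin.≟ # 0 ×-dec lookup ρ (# 1) Fin.≟ # 1 ×-dec All.all? (λ z → lookup ρ z ∈? Z) Z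
  where open import Data.List.Membership.DecPropositional (Fin._≟_ {12}) using (_∈?_)

marked-fixing : ∀ ρ → Fixing ρ → ∀ {𝓑} → Marked 𝓑 → Marked (relabel ρ 𝓑)
marked-fixing ρ (inj , ρ0 , ρ1 , ρZ) {𝓑} mk = record
  { tight   = tight-relabel (inj _ _) (tight mk)
  ; deg₀₁   = subst (_≤ 9) (sym (trans (deg-pull (lookup ρ) 𝓑 (# 0 ∷ # 1 ∷ [])) (cong₂ (λ a b → deg 𝓑 (a ∷ b ∷ [])) ρ0 ρ1))) (deg₀₁ mk)
  ; tripled = All.map (λ {z} ρz∈ → subst (_≤ 3)
      (sym (trans (deg-pull (lookup ρ) 𝓑 (z ∷ # 0 ∷ # 1 ∷ [])) (cong₂ (λ a b → deg 𝓑 (lookup ρ z ∷ a ∷ b ∷ [])) ρ0 ρ1)))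
      (All.lookup (tripled mk) ρz∈)) ρZ
  }

linked-fixing : ∀ ρ → Fixing ρ → ∀ {𝓑} → Linked (relabel ρ 𝓑) (# 0) (# 1) → Linked 𝓑 (# 0) (# 1)
linked-fixing ρ (inj , ρ0 , ρ1 , _) {𝓑} l = subst (λ a → Linked 𝓑 a (# 1)) ρ0 (subst (Linked 𝓑 _) ρ1 (linked-pull (λ {i} {j} → inj i j) {𝓑} l))

markedCaps : List (List Point × ℕ)
markedCaps = (# 0 ∷ # 1 ∷ [] , 9) ∷ map (λ s → (s ∷ # 0 ∷ # 1 ∷ [] , 4)) S ++ tightCaps Z

distinct₀₁ : ∀ zs {_ : True (All.all? (λ z → unique? (z ∷ # 0 ∷ # 1 ∷ [])) zs)} → All (λ z → Unique (z ∷ # 0 ∷ # 1 ∷ [])) zs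
distinct₀₁ zs {p} = toWitness p

markedCaps-sound : ∀ {𝓑} → Marked 𝓑 → All (λ (xs , c) → deg 𝓑 xs ≤ c) markedCaps
markedCaps-sound {𝓑} mk = deg₀₁ mk ∷ All.++⁺
  (All.map⁺ {f = λ s → (s ∷ # 0 ∷ # 1 ∷ [] , 4)} (All.map (λ {s} → deg₃-≤ (tight mk) {# 0} {# 1} {s}) (distinct₀₁ S)))
  (tightCaps-sound (Tight.cover (tight mk)) Z (distinct₀₁ Z) (tripled mk))

open Search 6 4 markedCaps Marked (λ 𝓑 → Linked 𝓑 (# 0) (# 1)) (Tight.cover ∘ tight) markedCaps-sound
  (does ∘ fixing?) (λ ρ p → marked-fixing ρ (does-true (fixing? ρ) p)) (λ ρ p {𝓑} → linked-fixing ρ (does-true (fixing? ρ) p) {𝓑})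

-- Dual certificates

infix 6 _·_
_·_ : ℕ → List ℕ → ℕ × List Point
w · xs = w , points xs

-- The blocks through 0 and 1, followed by dual weights for the linear program on the remaining blocks through 0.
-- The labels 0 and 1 are omitted from the blocks, the label 0 from the other lists.  A mate of 0 is to be labelled 2.
record Certificate : Set where
  field
    cap single : ℕ
    blocks pairs quads triples : List (ℕ × List Point)

  demand supply : List (Term 12)
  demand = (single , # 0 ∷ [] , 20)
    -- The degree of a six-point list is the multiplicity of that block, so these terms record the
    -- presence of the known blocks.
    ∷ map (λ (w , xs) → w , # 0 ∷ # 1 ∷ xs , 1) blocks
    ++ map (λ (w , xs) → w , # 0 ∷ xs , 1) quads
  supply = (cap , # 0 ∷ # 1 ∷ [] , 9)
    ∷ map (λ (w , xs) → w , xs ++ # 0 ∷ [] , 9) pairs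
    ++ map (λ (w , xs) → w , xs ++ # 0 ∷ [] , 4) triples

  config : Config 12
  config = map (λ (_ , xs) → fromPoints (# 0 ∷ # 1 ∷ xs)) blocks

  WellFormed : Set
  WellFormed = All (λ (_ , xs) → Unique (# 0 ∷ xs) × length xs ≡ 3) quads
    × All (λ (_ , xs) → Unique (xs ++ # 0 ∷ []) × length xs ≡ 2) triples
    × All (λ (_ , xs) → Unique (xs ++ # 2 ∷ # 0 ∷ []) × length xs ≡ 1) pairs

  wellFormed? : Dec WellFormed
  wellFormed? = All.all? (λ (_ , xs) → unique? (# 0 ∷ xs) ×-dec length xs ℕ.≟ 3) quads
    ×-dec All.all? (λ (_ , xs) → unique? (xs ++ # 0 ∷ []) ×-dec length xs ℕ.≟ 2) triples
    ×-dec All.all? (λ (_ , xs) → unique? (xs ++ # 2 ∷ # 0 ∷ []) ×-dec length xs ℕ.≟ 1) pairs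

  -- Infeasibility in the manner of Farkas: on every 6-set the demands weigh no more than the
  -- supplies, yet their bounds add up to more.
  valid : Bool
  valid = (value supply <ᵇ value demand) ∧ (does wellFormed? ∧ dominated (λ _ → true) 6 demand supply)

  refute : valid ≡ true → ∀ {𝓑} → Marked 𝓑 → All (_∈ 𝓑) config → All (λ (_ , xs) → deg 𝓑 (xs ++ # 0 ∷ []) ≤ 9) pairs → ⊥
  refute ok {𝓑} mk C⊆ small = ℕ.<⇒≱ (ℕ.<ᵇ⇒< _ _ (Equivalence.from T-≡ lt))
    (dual-bound (λ _ → true) 6 demand supply dom (Cover.sizes cov) (All.universal (λ _ → refl) 𝓑)
      (deg₁-≥ cov (# 0) ∷ All.++⁺ (All.map⁺ (All.map (λ {wx} → in-block {wx}) (All.map⁻ C⊆))) (All.map⁺ (All.map (λ {wx} → quad-≥ {wx}) qs)))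
      (deg₀₁ mk ∷ All.++⁺ (All.map⁺ small) (All.map⁺ (All.map (λ {(_ , xs)} → triple-≤ xs) ts))))
    where
    cov : Cover 12 6 4 𝓑
    cov = Tight.cover (tight mk)
    lt = proj₁ (∧-true ok)
    wf = does-true wellFormed? (proj₁ (∧-true (proj₂ (∧-true {value supply <ᵇ value demand} ok))))
    dom = proj₂ (∧-true {does wellFormed?} (proj₂ (∧-true {value supply <ᵇ value demand} ok)))
    qs = proj₁ wf
    ts = proj₁ (proj₂ wf)
    in-block : ∀ {wx : ℕ × List Point} → fromPoints (# 0 ∷ # 1 ∷ proj₂ wx) ∈ 𝓑 → 1 ≤ deg 𝓑 (# 0 ∷ # 1 ∷ proj₂ wx)
    in-block {_ , xs} = Any⇒1≤deg (# 0 ∷ # 1 ∷ xs) ∘ Any.map λ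
      { refl → ∈⇒⊑ (fromPoints (# 0 ∷ # 1 ∷ xs)) (# 0 ∷ # 1 ∷ xs) (fromPoints-∈ (# 0 ∷ # 1 ∷ xs)) }
    quad-≥ : ∀ {wx : ℕ × List Point} → Unique (# 0 ∷ proj₂ wx) × length (proj₂ wx) ≡ 3 → 1 ≤ deg 𝓑 (# 0 ∷ proj₂ wx)
    quad-≥ (u , l) = Cover.covers cov _ u (cong suc l)
    triple-≤ : ∀ xs → Unique (xs ++ # 0 ∷ []) × length xs ≡ 2 → deg 𝓑 (xs ++ # 0 ∷ []) ≤ 4
    triple-≤ (_ ∷ _ ∷ []) (u , _) = deg₃-≤ (tight mk) u

  -- Once 2 is the mate of 0, uniqueness of mates bounds the degree of every other pair through 0 by
  -- 9, as the weights in `pairs` presuppose.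
  refute-mate : valid ≡ true → ∀ {𝓑} → Marked 𝓑 → All (_∈ 𝓑) config → ¬ 10 ≤ deg 𝓑 (# 2 ∷ # 0 ∷ [])
  refute-mate ok {𝓑} mk C⊆ m = refute ok mk C⊆ (All.map (λ {(_ , xs)} → small xs) (proj₂ (proj₂ wf)))
    where
    wf = does-true wellFormed? (proj₁ (∧-true (proj₂ (∧-true {value supply <ᵇ value demand} ok))))
    small : ∀ xs → Unique (xs ++ # 2 ∷ # 0 ∷ []) × length xs ≡ 1 → deg 𝓑 (xs ++ # 0 ∷ []) ≤ 9
    small (_ ∷ []) (u , _) = ℕ.≤-pred (ℕ.≰⇒> (mates-unique (tight mk) u m))

open Certificate using (config; valid; refute; refute-mate)

labelling : List ℕ → Vec Point 12
labelling = go 12 ∘ (0 ∷_) ∘ (1 ∷_)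
  where
  go : ∀ k → List ℕ → Vec Point k
  go zero    _        = []
  -- A list that is too short repeats the label 0, and `fixing?` then rejects the labelling.
  go (suc k) []       = # 0 ∷ go k []
  go (suc k) (x ∷ xs) = (x mod 12) ∷ go k xs

_vias_ : ∃ Leads → List (List ℕ) → List Reference
target vias ρs = map (λ ρ → target via labelling ρ) ρs

positions : List (List ℕ) → List Point
positions = map (λ ρ → lookup (labelling ρ) (# 2))

symmetric : Config 12 → List ℕ → Bool
symmetric C ρ = does (fixing? (labelling ρ)) ∧ contains (relabel (labelling ρ) C) C

-- An automorphism of the known blocks moves a mate at `p` to the label 2, so one certificate serves
-- for all listed positions.
refute-positions : ∀ c → valid c ≡ true → ∀ ρs → all (symmetric (config c)) ρs ≡ true →
  ∀ {𝓑} → Marked 𝓑 → All (_∈ 𝓑) (config c) → ∀ {p} → p ∈ positions ρs → ¬ 10 ≤ deg 𝓑 (p ∷ # 0 ∷ [])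
refute-positions c ok ρs sym-ok {𝓑} mk C⊆ p∈ m with ∈-map⁻ _ p∈
... | ρ , ρ∈ , refl =
  let fx , ct = ∧-true (All.lookup (all-true (symmetric (config c)) ρs sym-ok) ρ∈)
      fixing = does-true (fixing? (labelling ρ)) fx
      ρ0 = proj₁ (proj₂ fixing)
  in refute-mate c ok (marked-fixing (labelling ρ) fixing mk)
       (contains-sound (config c) ct (All.map⁺ (All.map (∈-map⁺ _) C⊆)))
       (subst (10 ≤_) (sym (trans (deg-pull (lookup (labelling ρ)) 𝓑 (# 2 ∷ # 0 ∷ []))
         (cong (λ a → deg 𝓑 (lookup (labelling ρ) (# 2) ∷ a ∷ [])) ρ0))) m)

-- A triple containing two mates has degree at least 4, so a point of `Z` cannot be the mate of 0;
-- nor can 1, by `deg₀₁`.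
mate-position : ∀ {𝓑} → Marked 𝓑 → ∃ λ p → p ∈ S × 10 ≤ deg 𝓑 (p ∷ # 0 ∷ [])
mate-position {𝓑} mk with mate (tight mk) (# 0)
... | p , u , m = p , ∈S p u m (∈S? p) , m
  where
  open import Data.List.Membership.DecPropositional (Fin._≟_ {12}) using (_∈?_)
  ∈S? : ∀ p → Dec (p ∈ S)
  ∈S? p = p ∈? S
  ∈Z : ∀ p → p ∉ S → p ≢ # 0 → p ≢ # 1 → p ∈ Z
  ∈Z = toWitness {a? = Fin.all? λ p → ¬? (p ∈? S) →-dec ¬? (p Fin.≟ # 0) →-dec ¬? (p Fin.≟ # 1) →-dec p ∈? Z} _
  ∈S : ∀ p → Unique (p ∷ # 0 ∷ []) → 10 ≤ deg 𝓑 (p ∷ # 0 ∷ []) → Dec (p ∈ S) → p ∈ S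
  ∈S p u m (yes p∈) = p∈
  ∈S p ((p≢0 ∷ []) ∷ _) m (no p∉) with p Fin.≟ # 1
  ... | yes refl = contradiction (deg₀₁ mk) (ℕ.<⇒≱ (subst (10 ≤_) (deg-↭ 𝓑 (# 1 ∷ # 0 ∷ []) (# 0 ∷ # 1 ∷ []) (↭.↭-swap _ _ ↭.↭-refl)) m))
  ... | no p≢1   = contradiction (All.lookup (tripled mk) (∈Z p p∉ p≢0 p≢1))
    (ℕ.<⇒≱ (subst (4 ≤_) (deg-↭ 𝓑 (# 1 ∷ p ∷ # 0 ∷ []) (p ∷ # 0 ∷ # 1 ∷ [])
      (↭.↭-trans (↭.↭-swap _ _ ↭.↭-refl) (↭.↭-prep p (↭.↭-swap _ _ ↭.↭-refl))))
      (deg₃-mates-≥ (tight mk) ((≢-sym p≢1 ∷ (λ ()) ∷ []) ∷ (p≢0 ∷ []) ∷ [] ∷ []) m)))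

quad : (a b c d : ℕ) → Subset 12
quad a b c d = fromPoints (points (0 ∷ 1 ∷ a ∷ b ∷ c ∷ d ∷ []))

star : Point → List Point → List (List Point)
star a = map λ b → # 0 ∷ # 1 ∷ a ∷ b ∷ []

-- The four (10,4,2) coverings with nine blocks are named after the multigraph of their repeated pairs, in which every
-- point of S has valency 3: a hexagon with alternate edges doubled, a tetrahedron and a triple edge, a square with two
-- opposite edges doubled and a triple edge, and three triple edges.  The weights are scaled optimal solutions of the
-- dual linear programs, computed by the simplex method.

hexagonCertificate : Certificate
hexagonCertificate = record
  { cap     = 6
  ; single  = 12
  ; blocks  = 17 · (2 ∷ 3 ∷ 4 ∷ 6 ∷ []) ∷ 5 · (2 ∷ 3 ∷ 8 ∷ 9 ∷ []) ∷ 5 · (2 ∷ 3 ∷ 10 ∷ 11 ∷ []) ∷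
              17 · (2 ∷ 4 ∷ 5 ∷ 7 ∷ []) ∷ 17 · (3 ∷ 5 ∷ 6 ∷ 7 ∷ []) ∷ 11 · (4 ∷ 5 ∷ 8 ∷ 10 ∷ []) ∷
              11 · (4 ∷ 5 ∷ 9 ∷ 11 ∷ []) ∷ 11 · (6 ∷ 7 ∷ 8 ∷ 11 ∷ []) ∷ 11 · (6 ∷ 7 ∷ 9 ∷ 10 ∷ []) ∷ []
  ; pairs   = 7 · (4 ∷ []) ∷ 7 · (5 ∷ []) ∷ 8 · (6 ∷ []) ∷ 8 · (7 ∷ []) ∷ []
  ; quads   = 4 · (2 ∷ 3 ∷ 5 ∷ []) ∷ 5 · (2 ∷ 3 ∷ 7 ∷ []) ∷ 4 · (2 ∷ 6 ∷ 7 ∷ []) ∷ 4 · (3 ∷ 4 ∷ 5 ∷ []) ∷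
              3 · (4 ∷ 5 ∷ 6 ∷ []) ∷ 3 · (4 ∷ 6 ∷ 7 ∷ []) ∷ 2 · (4 ∷ 6 ∷ 8 ∷ []) ∷ 2 · (4 ∷ 6 ∷ 9 ∷ []) ∷
              2 · (4 ∷ 6 ∷ 10 ∷ []) ∷ 2 · (4 ∷ 6 ∷ 11 ∷ []) ∷ 2 · (4 ∷ 7 ∷ 8 ∷ []) ∷ 2 · (4 ∷ 7 ∷ 9 ∷ []) ∷
              2 · (4 ∷ 7 ∷ 10 ∷ []) ∷ 2 · (4 ∷ 7 ∷ 11 ∷ []) ∷ 1 · (4 ∷ 8 ∷ 9 ∷ []) ∷ 1 · (4 ∷ 10 ∷ 11 ∷ []) ∷
              2 · (5 ∷ 6 ∷ 8 ∷ []) ∷ 2 · (5 ∷ 6 ∷ 9 ∷ []) ∷ 2 · (5 ∷ 6 ∷ 10 ∷ []) ∷ 2 · (5 ∷ 6 ∷ 11 ∷ []) ∷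
              2 · (5 ∷ 7 ∷ 8 ∷ []) ∷ 2 · (5 ∷ 7 ∷ 9 ∷ []) ∷ 2 · (5 ∷ 7 ∷ 10 ∷ []) ∷ 2 · (5 ∷ 7 ∷ 11 ∷ []) ∷
              1 · (5 ∷ 8 ∷ 9 ∷ []) ∷ 1 · (5 ∷ 10 ∷ 11 ∷ []) ∷ 1 · (6 ∷ 8 ∷ 9 ∷ []) ∷ 1 · (6 ∷ 8 ∷ 10 ∷ []) ∷
              1 · (6 ∷ 9 ∷ 11 ∷ []) ∷ 1 · (6 ∷ 10 ∷ 11 ∷ []) ∷ 1 · (7 ∷ 8 ∷ 9 ∷ []) ∷ 1 · (7 ∷ 8 ∷ 10 ∷ []) ∷
              1 · (7 ∷ 9 ∷ 11 ∷ []) ∷ 1 · (7 ∷ 10 ∷ 11 ∷ []) ∷ []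
  ; triples = 8 · (2 ∷ 3 ∷ []) ∷ 1 · (4 ∷ 5 ∷ []) ∷ 3 · (8 ∷ 9 ∷ []) ∷ 2 · (8 ∷ 10 ∷ []) ∷ 1 · (8 ∷ 11 ∷ []) ∷
              1 · (9 ∷ 10 ∷ []) ∷ 2 · (9 ∷ 11 ∷ []) ∷ 3 · (10 ∷ 11 ∷ []) ∷ []
  }

tetrahedronCertificate : Certificate
tetrahedronCertificate = record
  { cap     = 48
  ; single  = 57
  ; blocks  = 237 · (2 ∷ 3 ∷ 4 ∷ 8 ∷ []) ∷ 237 · (2 ∷ 3 ∷ 5 ∷ 9 ∷ []) ∷ 237 · (2 ∷ 4 ∷ 5 ∷ 10 ∷ []) ∷
              174 · (2 ∷ 6 ∷ 7 ∷ 11 ∷ []) ∷ 360 · (3 ∷ 4 ∷ 5 ∷ 11 ∷ []) ∷ 294 · (3 ∷ 6 ∷ 7 ∷ 10 ∷ []) ∷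
              294 · (4 ∷ 6 ∷ 7 ∷ 9 ∷ []) ∷ 294 · (5 ∷ 6 ∷ 7 ∷ 8 ∷ []) ∷ 45 · (8 ∷ 9 ∷ 10 ∷ 11 ∷ []) ∷ []
  ; pairs   = 123 · (3 ∷ []) ∷ 123 · (4 ∷ []) ∷ 123 · (5 ∷ []) ∷ 48 · (6 ∷ []) ∷ 48 · (7 ∷ []) ∷ []
  ; quads   = 38 · (2 ∷ 3 ∷ 6 ∷ []) ∷ 38 · (2 ∷ 3 ∷ 7 ∷ []) ∷ 22 · (2 ∷ 3 ∷ 10 ∷ []) ∷ 9 · (2 ∷ 3 ∷ 11 ∷ []) ∷
              38 · (2 ∷ 4 ∷ 6 ∷ []) ∷ 38 · (2 ∷ 4 ∷ 7 ∷ []) ∷ 22 · (2 ∷ 4 ∷ 9 ∷ []) ∷ 9 · (2 ∷ 4 ∷ 11 ∷ []) ∷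
              38 · (2 ∷ 5 ∷ 6 ∷ []) ∷ 38 · (2 ∷ 5 ∷ 7 ∷ []) ∷ 22 · (2 ∷ 5 ∷ 8 ∷ []) ∷ 9 · (2 ∷ 5 ∷ 11 ∷ []) ∷
              82 · (3 ∷ 4 ∷ 6 ∷ []) ∷ 82 · (3 ∷ 4 ∷ 7 ∷ []) ∷ 22 · (3 ∷ 4 ∷ 9 ∷ []) ∷ 22 · (3 ∷ 4 ∷ 10 ∷ []) ∷
              82 · (3 ∷ 5 ∷ 6 ∷ []) ∷ 82 · (3 ∷ 5 ∷ 7 ∷ []) ∷ 22 · (3 ∷ 5 ∷ 8 ∷ []) ∷ 22 · (3 ∷ 5 ∷ 10 ∷ []) ∷
              35 · (3 ∷ 6 ∷ 8 ∷ []) ∷ 35 · (3 ∷ 6 ∷ 9 ∷ []) ∷ 32 · (3 ∷ 6 ∷ 11 ∷ []) ∷ 35 · (3 ∷ 7 ∷ 8 ∷ []) ∷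
              35 · (3 ∷ 7 ∷ 9 ∷ []) ∷ 32 · (3 ∷ 7 ∷ 11 ∷ []) ∷ 9 · (3 ∷ 8 ∷ 9 ∷ []) ∷ 22 · (3 ∷ 8 ∷ 10 ∷ []) ∷
              18 · (3 ∷ 8 ∷ 11 ∷ []) ∷ 22 · (3 ∷ 9 ∷ 10 ∷ []) ∷ 18 · (3 ∷ 9 ∷ 11 ∷ []) ∷ 31 · (3 ∷ 10 ∷ 11 ∷ []) ∷
              82 · (4 ∷ 5 ∷ 6 ∷ []) ∷ 82 · (4 ∷ 5 ∷ 7 ∷ []) ∷ 22 · (4 ∷ 5 ∷ 8 ∷ []) ∷ 22 · (4 ∷ 5 ∷ 9 ∷ []) ∷
              35 · (4 ∷ 6 ∷ 8 ∷ []) ∷ 35 · (4 ∷ 6 ∷ 10 ∷ []) ∷ 32 · (4 ∷ 6 ∷ 11 ∷ []) ∷ 35 · (4 ∷ 7 ∷ 8 ∷ []) ∷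
              35 · (4 ∷ 7 ∷ 10 ∷ []) ∷ 32 · (4 ∷ 7 ∷ 11 ∷ []) ∷ 22 · (4 ∷ 8 ∷ 9 ∷ []) ∷ 9 · (4 ∷ 8 ∷ 10 ∷ []) ∷
              18 · (4 ∷ 8 ∷ 11 ∷ []) ∷ 22 · (4 ∷ 9 ∷ 10 ∷ []) ∷ 31 · (4 ∷ 9 ∷ 11 ∷ []) ∷ 18 · (4 ∷ 10 ∷ 11 ∷ []) ∷
              35 · (5 ∷ 6 ∷ 9 ∷ []) ∷ 35 · (5 ∷ 6 ∷ 10 ∷ []) ∷ 32 · (5 ∷ 6 ∷ 11 ∷ []) ∷ 35 · (5 ∷ 7 ∷ 9 ∷ []) ∷
              35 · (5 ∷ 7 ∷ 10 ∷ []) ∷ 32 · (5 ∷ 7 ∷ 11 ∷ []) ∷ 22 · (5 ∷ 8 ∷ 9 ∷ []) ∷ 22 · (5 ∷ 8 ∷ 10 ∷ []) ∷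
              31 · (5 ∷ 8 ∷ 11 ∷ []) ∷ 9 · (5 ∷ 9 ∷ 10 ∷ []) ∷ 18 · (5 ∷ 9 ∷ 11 ∷ []) ∷ 18 · (5 ∷ 10 ∷ 11 ∷ []) ∷ []
  ; triples = 3 · (2 ∷ 11 ∷ []) ∷ 84 · (6 ∷ 7 ∷ []) ∷ 3 · (8 ∷ 9 ∷ []) ∷ 3 · (8 ∷ 10 ∷ []) ∷ 15 · (8 ∷ 11 ∷ []) ∷
              3 · (9 ∷ 10 ∷ []) ∷ 15 · (9 ∷ 11 ∷ []) ∷ 15 · (10 ∷ 11 ∷ []) ∷ []
  }

squareCertificate : Certificate
squareCertificate = record
  { cap     = 0
  ; single  = 0
  ; blocks  = 1 · (2 ∷ 3 ∷ 4 ∷ 6 ∷ []) ∷ 1 · (2 ∷ 3 ∷ 5 ∷ 7 ∷ []) ∷ 1 · (2 ∷ 3 ∷ 8 ∷ 9 ∷ []) ∷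
              1 · (2 ∷ 3 ∷ 10 ∷ 11 ∷ []) ∷ 2 · (4 ∷ 5 ∷ 6 ∷ 7 ∷ []) ∷ 1 · (4 ∷ 5 ∷ 8 ∷ 10 ∷ []) ∷
              1 · (4 ∷ 5 ∷ 9 ∷ 11 ∷ []) ∷ 1 · (6 ∷ 7 ∷ 8 ∷ 11 ∷ []) ∷ 1 · (6 ∷ 7 ∷ 9 ∷ 10 ∷ []) ∷ []
  ; pairs   = []
  ; quads   = 1 · (2 ∷ 4 ∷ 5 ∷ []) ∷ 1 · (2 ∷ 6 ∷ 7 ∷ []) ∷ 1 · (3 ∷ 4 ∷ 5 ∷ []) ∷ 1 · (3 ∷ 6 ∷ 7 ∷ []) ∷ []
  ; triples = 1 · (2 ∷ 3 ∷ []) ∷ 1 · (4 ∷ 5 ∷ []) ∷ 1 · (6 ∷ 7 ∷ []) ∷ []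
  }

edgesCertificate : Certificate
edgesCertificate = record
  { cap     = 4
  ; single  = 14
  ; blocks  = 1 · (2 ∷ 3 ∷ 4 ∷ 5 ∷ []) ∷ 1 · (2 ∷ 3 ∷ 6 ∷ 7 ∷ []) ∷ 4 · (2 ∷ 3 ∷ 8 ∷ 9 ∷ []) ∷
              2 · (2 ∷ 3 ∷ 10 ∷ 11 ∷ []) ∷ 4 · (4 ∷ 5 ∷ 6 ∷ 7 ∷ []) ∷ 6 · (4 ∷ 5 ∷ 8 ∷ 10 ∷ []) ∷
              6 · (4 ∷ 5 ∷ 9 ∷ 11 ∷ []) ∷ 6 · (6 ∷ 7 ∷ 8 ∷ 11 ∷ []) ∷ 6 · (6 ∷ 7 ∷ 9 ∷ 10 ∷ []) ∷ []
  ; pairs   = 3 · (4 ∷ []) ∷ 3 · (5 ∷ []) ∷ 3 · (6 ∷ []) ∷ 3 · (7 ∷ []) ∷ 5 · (8 ∷ []) ∷ 5 · (9 ∷ []) ∷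
              4 · (10 ∷ []) ∷ 4 · (11 ∷ []) ∷ []
  ; quads   = 1 · (4 ∷ 8 ∷ 9 ∷ []) ∷ 1 · (4 ∷ 8 ∷ 11 ∷ []) ∷ 1 · (4 ∷ 9 ∷ 10 ∷ []) ∷ 1 · (5 ∷ 8 ∷ 9 ∷ []) ∷
              1 · (5 ∷ 8 ∷ 11 ∷ []) ∷ 1 · (5 ∷ 9 ∷ 10 ∷ []) ∷ 1 · (6 ∷ 8 ∷ 9 ∷ []) ∷ 1 · (6 ∷ 8 ∷ 10 ∷ []) ∷
              1 · (6 ∷ 9 ∷ 11 ∷ []) ∷ 1 · (7 ∷ 8 ∷ 9 ∷ []) ∷ 1 · (7 ∷ 8 ∷ 10 ∷ []) ∷ 1 · (7 ∷ 9 ∷ 11 ∷ []) ∷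
              1 · (8 ∷ 9 ∷ 10 ∷ []) ∷ 1 · (8 ∷ 9 ∷ 11 ∷ []) ∷ 1 · (8 ∷ 10 ∷ 11 ∷ []) ∷ 1 · (9 ∷ 10 ∷ 11 ∷ []) ∷ []
  ; triples = 4 · (2 ∷ 3 ∷ []) ∷ 1 · (4 ∷ 5 ∷ []) ∷ 1 · (6 ∷ 7 ∷ []) ∷ []
  }

-- The first entries run through all of `S`, so every possible mate of 0 is excluded.
hexagonSymmetries : List (List ℕ)
hexagonSymmetries = (2 ∷ 3 ∷ 4 ∷ 5 ∷ 6 ∷ 7 ∷ 8 ∷ 9 ∷ 10 ∷ 11 ∷ []) ∷ (3 ∷ 2 ∷ 6 ∷ 7 ∷ 4 ∷ 5 ∷ 8 ∷ 9 ∷ 11 ∷ 10 ∷ []) ∷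
                    (4 ∷ 5 ∷ 2 ∷ 3 ∷ 7 ∷ 6 ∷ 8 ∷ 10 ∷ 9 ∷ 11 ∷ []) ∷ (5 ∷ 4 ∷ 7 ∷ 6 ∷ 2 ∷ 3 ∷ 8 ∷ 10 ∷ 11 ∷ 9 ∷ []) ∷
                    (6 ∷ 7 ∷ 3 ∷ 2 ∷ 5 ∷ 4 ∷ 8 ∷ 11 ∷ 9 ∷ 10 ∷ []) ∷ (7 ∷ 6 ∷ 5 ∷ 4 ∷ 3 ∷ 2 ∷ 8 ∷ 11 ∷ 10 ∷ 9 ∷ []) ∷ []

edgesSymmetries : List (List ℕ)
edgesSymmetries = (2 ∷ 3 ∷ 4 ∷ 5 ∷ 6 ∷ 7 ∷ 8 ∷ 9 ∷ 10 ∷ 11 ∷ []) ∷ (3 ∷ 2 ∷ 4 ∷ 5 ∷ 6 ∷ 7 ∷ 8 ∷ 9 ∷ 10 ∷ 11 ∷ []) ∷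
                  (4 ∷ 5 ∷ 2 ∷ 3 ∷ 6 ∷ 7 ∷ 8 ∷ 10 ∷ 9 ∷ 11 ∷ []) ∷ (5 ∷ 4 ∷ 2 ∷ 3 ∷ 6 ∷ 7 ∷ 8 ∷ 10 ∷ 9 ∷ 11 ∷ []) ∷
                  (6 ∷ 7 ∷ 2 ∷ 3 ∷ 4 ∷ 5 ∷ 8 ∷ 11 ∷ 9 ∷ 10 ∷ []) ∷ (7 ∷ 6 ∷ 2 ∷ 3 ∷ 4 ∷ 5 ∷ 8 ∷ 11 ∷ 9 ∷ 10 ∷ []) ∷ []

-- These reach only the vertices of the tetrahedron; the ends 6 and 7 of the triple edge stay
-- possible.
tetrahedronSymmetries : List (List ℕ)
tetrahedronSymmetries = (2 ∷ 3 ∷ 4 ∷ 5 ∷ 6 ∷ 7 ∷ 8 ∷ 9 ∷ 10 ∷ 11 ∷ []) ∷ (3 ∷ 2 ∷ 4 ∷ 5 ∷ 6 ∷ 7 ∷ 8 ∷ 9 ∷ 11 ∷ 10 ∷ []) ∷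
                        (4 ∷ 2 ∷ 3 ∷ 5 ∷ 6 ∷ 7 ∷ 8 ∷ 10 ∷ 11 ∷ 9 ∷ []) ∷ (5 ∷ 2 ∷ 3 ∷ 4 ∷ 6 ∷ 7 ∷ 9 ∷ 10 ∷ 11 ∷ 8 ∷ []) ∷ []

hexagonConfig : Config 12
hexagonConfig = config hexagonCertificate

tetrahedronConfig : Config 12
tetrahedronConfig = config tetrahedronCertificate

squareConfig : Config 12
squareConfig = config squareCertificate

edgesConfig : Config 12
edgesConfig = config edgesCertificate

hexagon-leads : Leads hexagonConfig
hexagon-leads mk C⊆ = let p , p∈ , m = mate-position mk in
  ⊥-elim (refute-positions hexagonCertificate refl hexagonSymmetries refl mk C⊆ p∈ m)

edges-leads : Leads edgesConfig
edges-leads mk C⊆ = let p , p∈ , m = mate-position mk in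
  ⊥-elim (refute-positions edgesCertificate refl edgesSymmetries refl mk C⊆ p∈ m)

-- The contradiction is visible without mates: four known blocks exhaust the triple 0 2 3, and 0 4 5
-- has room for one more block. That block would have to cover both 0 2 4 5 and 0 3 4 5, and so
-- contain 0 2 3 again.
square-leads : Leads squareConfig
square-leads mk C⊆ = ⊥-elim (refute squareCertificate refl mk C⊆ [])

-- Carries results on the mate of 0 over to the mate of 1.
exchange : Vec Point 12
exchange = Vec.map (_mod 12) (1 ∷ 0 ∷ 2 ∷ 3 ∷ 4 ∷ 5 ∷ 6 ∷ 7 ∷ 8 ∷ 9 ∷ 10 ∷ 11 ∷ [])

marked-exchange : ∀ {𝓑} → Marked 𝓑 → Marked (relabel exchange 𝓑)
marked-exchange {𝓑} mk = record
  { tight   = tight-relabel (λ {i} {j} → toWitness {a? = injective? (lookup exchange)} _ i j) (tight mk)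
  ; deg₀₁   = subst (_≤ 9) (sym (trans (deg-pull (lookup exchange) 𝓑 (# 0 ∷ # 1 ∷ []))
      (deg-↭ 𝓑 (# 1 ∷ # 0 ∷ []) (# 0 ∷ # 1 ∷ []) (↭.↭-swap _ _ ↭.↭-refl)))) (deg₀₁ mk)
  ; tripled = All.zipWith (λ {z} (eq , le) → subst (_≤ 3) (sym (moved z eq)) le)
      (toWitness {a? = All.all? (λ z → lookup exchange z Fin.≟ z) Z} _ , tripled mk)
  }
  where
  moved : ∀ z → lookup exchange z ≡ z → deg (relabel exchange 𝓑) (z ∷ # 0 ∷ # 1 ∷ []) ≡ deg 𝓑 (z ∷ # 0 ∷ # 1 ∷ [])
  moved z eq = trans (deg-pull (lookup exchange) 𝓑 (z ∷ # 0 ∷ # 1 ∷ []))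
    (trans (cong (λ a → deg 𝓑 (a ∷ # 1 ∷ # 0 ∷ [])) eq)
      (deg-↭ 𝓑 (z ∷ # 1 ∷ # 0 ∷ []) (z ∷ # 0 ∷ # 1 ∷ []) (↭.↭-prep z (↭.↭-swap _ _ ↭.↭-refl))))

tetrahedron-valid : valid tetrahedronCertificate ≡ true
tetrahedron-valid = refl

-- The certificate, applied to 0 and to 1, leaves 6 and 7 for both mates. They are different because
-- mates are unique, and 6 and 7 share four of the nine blocks.
tetrahedron-leads : Leads tetrahedronConfig
tetrahedron-leads {𝓑} mk C⊆ =
  let p , p∈ , a = mate-position mk
      q , q∈ , b = mate-position (marked-exchange mk)
      p∈₆₇ = apex p∈ (refute-positions tetrahedronCertificate tetrahedron-valid tetrahedronSymmetries refl mk C⊆) a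
      q∈₆₇ = apex q∈ (refute-positions tetrahedronCertificate tetrahedron-valid tetrahedronSymmetries refl (marked-exchange mk) C⊆′) b
      b′   = subst (10 ≤_) (trans (deg-pull (lookup exchange) 𝓑 (q ∷ # 0 ∷ [])) (cong (λ a → deg 𝓑 (a ∷ # 1 ∷ [])) (fixed q∈₆₇))) b
  in conclude p q p∈₆₇ q∈₆₇ a b′
  where
  open import Data.List.Membership.DecPropositional (Fin._≟_ {12}) using (_∈?_)
  C⊆′ : All (_∈ relabel exchange 𝓑) tetrahedronConfig
  C⊆′ = contains-sound tetrahedronConfig refl (All.map⁺ (All.map (∈-map⁺ _) C⊆))
  apex : ∀ {A : Point → Set} {p} → p ∈ S → (∀ {p} → p ∈ positions tetrahedronSymmetries → ¬ A p) → A p → p ∈ points (6 ∷ 7 ∷ [])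
  apex (here refl)                         f a = contradiction a (f (here refl))
  apex (there (here refl))                 f a = contradiction a (f (there (here refl)))
  apex (there (there (here refl)))         f a = contradiction a (f (there (there (here refl))))
  apex (there (there (there (here refl)))) f a = contradiction a (f (there (there (there (here refl)))))
  apex (there (there (there (there p∈))))  f a = p∈
  fixed : ∀ {q} → q ∈ points (6 ∷ 7 ∷ []) → lookup exchange q ≡ q
  fixed (here refl)         = refl
  fixed (there (here refl)) = refl
  count : deg tetrahedronConfig (# 6 ∷ # 7 ∷ # 0 ∷ # 1 ∷ []) ≡ 4
  count = refl
  together : 4 ≤ deg 𝓑 (# 6 ∷ # 7 ∷ # 0 ∷ # 1 ∷ [])
  together = subst (_≤ deg 𝓑 (# 6 ∷ # 7 ∷ # 0 ∷ # 1 ∷ [])) count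
    (deg-⊆ (toWitness {a? = DecUnique.unique? (≡-dec _≟ᵇ_) tetrahedronConfig} _) C⊆ (# 6 ∷ # 7 ∷ # 0 ∷ # 1 ∷ []))
  both : ∀ {p} → Unique (# 1 ∷ # 0 ∷ p ∷ []) → 10 ≤ deg 𝓑 (p ∷ # 0 ∷ []) → ¬ 10 ≤ deg 𝓑 (p ∷ # 1 ∷ [])
  both {p} u a b = mates-unique (tight mk) u (subst (10 ≤_) (deg-↭ 𝓑 (p ∷ # 0 ∷ []) (# 0 ∷ p ∷ []) (↭.↭-swap _ _ ↭.↭-refl)) a)
    (subst (10 ≤_) (deg-↭ 𝓑 (p ∷ # 1 ∷ []) (# 1 ∷ p ∷ []) (↭.↭-swap _ _ ↭.↭-refl)) b)
  conclude : ∀ p q → p ∈ points (6 ∷ 7 ∷ []) → q ∈ points (6 ∷ 7 ∷ []) →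
             10 ≤ deg 𝓑 (p ∷ # 0 ∷ []) → 10 ≤ deg 𝓑 (q ∷ # 1 ∷ []) → Linked 𝓑 (# 0) (# 1)
  conclude _ _ (here refl)         (here refl)         a b = contradiction b (both (toWitness {a? = unique? (# 1 ∷ # 0 ∷ # 6 ∷ [])} _) a)
  conclude _ _ (there (here refl)) (there (here refl)) a b = contradiction b (both (toWitness {a? = unique? (# 1 ∷ # 0 ∷ # 7 ∷ [])} _) a)
  conclude _ _ (here refl)         (there (here refl)) a b =
    # 6 , # 7 , toWitness {a? = unique? (# 6 ∷ # 7 ∷ # 0 ∷ # 1 ∷ [])} _ , a , b , together
  conclude _ _ (there (here refl)) (here refl)         a b =
    # 7 , # 6 , toWitness {a? = unique? (# 7 ∷ # 6 ∷ # 0 ∷ # 1 ∷ [])} _ , a , b ,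
    subst (4 ≤_) (deg-↭ 𝓑 (# 6 ∷ # 7 ∷ # 0 ∷ # 1 ∷ []) (# 7 ∷ # 6 ∷ # 0 ∷ # 1 ∷ []) (↭.↭-swap _ _ ↭.↭-refl)) together

-- The (10,4,2) coverings with nine blocks

-- The search starts from the block through 0, 1, 8 and 9, which contains two, one or no further points of Z.
-- Reference labellings send the labels of the earlier configuration to those of the current one.

matchedConfig : Config 12
matchedConfig = quad 2 3 8 9 ∷ quad 2 3 10 11 ∷ quad 4 5 8 10 ∷ quad 4 5 9 11 ∷
                quad 6 7 8 11 ∷ quad 6 7 9 10 ∷ []

-- Every point of `Z` already has its three blocks, so the at most three others consist of 0, 1 and
-- four points of `S`.
matched-leads : Leads matchedConfig
matched-leads = explore matchedConfig (pairsThrough S)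
  ((_ , hexagon-leads) vias
      ((2 ∷ 3 ∷ 4 ∷ 5 ∷ 6 ∷ 7 ∷ 8 ∷ 9 ∷ 10 ∷ 11 ∷ []) ∷ (3 ∷ 2 ∷ 4 ∷ 5 ∷ 6 ∷ 7 ∷ 8 ∷ 9 ∷ 10 ∷ 11 ∷ []) ∷
       (2 ∷ 3 ∷ 4 ∷ 5 ∷ 7 ∷ 6 ∷ 8 ∷ 9 ∷ 10 ∷ 11 ∷ []) ∷ (3 ∷ 2 ∷ 4 ∷ 5 ∷ 7 ∷ 6 ∷ 8 ∷ 9 ∷ 10 ∷ 11 ∷ []) ∷
       (2 ∷ 3 ∷ 5 ∷ 4 ∷ 7 ∷ 6 ∷ 8 ∷ 9 ∷ 10 ∷ 11 ∷ []) ∷ (2 ∷ 3 ∷ 5 ∷ 4 ∷ 6 ∷ 7 ∷ 8 ∷ 9 ∷ 10 ∷ 11 ∷ []) ∷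
       (3 ∷ 2 ∷ 5 ∷ 4 ∷ 6 ∷ 7 ∷ 8 ∷ 9 ∷ 10 ∷ 11 ∷ []) ∷ (3 ∷ 2 ∷ 5 ∷ 4 ∷ 7 ∷ 6 ∷ 8 ∷ 9 ∷ 10 ∷ 11 ∷ []) ∷ []) ++
   (_ , square-leads) vias
      ((6 ∷ 7 ∷ 2 ∷ 3 ∷ 4 ∷ 5 ∷ 8 ∷ 11 ∷ 9 ∷ 10 ∷ []) ∷ (6 ∷ 7 ∷ 2 ∷ 3 ∷ 5 ∷ 4 ∷ 8 ∷ 11 ∷ 9 ∷ 10 ∷ []) ∷
       (2 ∷ 3 ∷ 4 ∷ 5 ∷ 6 ∷ 7 ∷ 8 ∷ 9 ∷ 10 ∷ 11 ∷ []) ∷ (2 ∷ 3 ∷ 4 ∷ 5 ∷ 7 ∷ 6 ∷ 8 ∷ 9 ∷ 10 ∷ 11 ∷ []) ∷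
       (4 ∷ 5 ∷ 2 ∷ 3 ∷ 6 ∷ 7 ∷ 8 ∷ 10 ∷ 9 ∷ 11 ∷ []) ∷ (4 ∷ 5 ∷ 2 ∷ 3 ∷ 7 ∷ 6 ∷ 8 ∷ 10 ∷ 9 ∷ 11 ∷ []) ∷ []) ++
   (_ , edges-leads) vias
      ((2 ∷ 3 ∷ 4 ∷ 5 ∷ 6 ∷ 7 ∷ 8 ∷ 9 ∷ 10 ∷ 11 ∷ []) ∷ [])) refl

splitConfig : Config 12
splitConfig = quad 2 3 8 9 ∷ []

-- The two points of `S` in the block through 8 and 10 determine the other blocks that meet `Z`; the
-- six labellings are the choices of two points among 4, 5, 6 and 7.
split-leads : Leads splitConfig
split-leads = explore splitConfig (pairsThrough Z)
  ((_ , matched-leads) vias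
      ((2 ∷ 3 ∷ 4 ∷ 5 ∷ 6 ∷ 7 ∷ 8 ∷ 9 ∷ 10 ∷ 11 ∷ []) ∷ (2 ∷ 3 ∷ 4 ∷ 6 ∷ 5 ∷ 7 ∷ 8 ∷ 9 ∷ 10 ∷ 11 ∷ []) ∷
       (2 ∷ 3 ∷ 4 ∷ 7 ∷ 5 ∷ 6 ∷ 8 ∷ 9 ∷ 10 ∷ 11 ∷ []) ∷ (2 ∷ 3 ∷ 5 ∷ 6 ∷ 4 ∷ 7 ∷ 8 ∷ 9 ∷ 10 ∷ 11 ∷ []) ∷
       (2 ∷ 3 ∷ 5 ∷ 7 ∷ 4 ∷ 6 ∷ 8 ∷ 9 ∷ 10 ∷ 11 ∷ []) ∷ (2 ∷ 3 ∷ 6 ∷ 7 ∷ 4 ∷ 5 ∷ 8 ∷ 9 ∷ 10 ∷ 11 ∷ []) ∷ [])) refl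

bisected²Config : Config 12
bisected²Config = quad 8 9 10 11 ∷ quad 2 3 4 8 ∷ quad 5 6 7 8 ∷ quad 2 3 5 9 ∷
                  quad 4 6 7 9 ∷ []

-- The pairs 2 3 and 6 7 are already repeated. Either may become the triple edge, and 10 and 11 may
-- change roles, hence four labellings.
bisected²-leads : Leads bisected²Config
bisected²-leads = explore bisected²Config (pairsThrough (points (10 ∷ 11 ∷ []) ++ S))
  ((_ , tetrahedron-leads) vias
      ((7 ∷ 6 ∷ 5 ∷ 4 ∷ 2 ∷ 3 ∷ 8 ∷ 9 ∷ 10 ∷ 11 ∷ []) ∷ (6 ∷ 7 ∷ 5 ∷ 4 ∷ 2 ∷ 3 ∷ 8 ∷ 9 ∷ 10 ∷ 11 ∷ []) ∷
       (2 ∷ 3 ∷ 4 ∷ 5 ∷ 6 ∷ 7 ∷ 8 ∷ 9 ∷ 10 ∷ 11 ∷ []) ∷ (3 ∷ 2 ∷ 4 ∷ 5 ∷ 6 ∷ 7 ∷ 8 ∷ 9 ∷ 10 ∷ 11 ∷ []) ∷ [])) refl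

doubledConfig : Config 12
doubledConfig = quad 8 9 10 11 ∷ quad 2 3 4 8 ∷ quad 5 6 7 8 ∷ quad 2 3 4 9 ∷
                quad 5 6 7 9 ∷ []

-- No completion exists: all nine blocks meet `Z`, and a halving of `S` other than the one shared by
-- 8 and 9 covers four of the nine pairs between its halves, so 10 and 11 cover at most eight.
doubled-leads : Leads doubledConfig
doubled-leads = explore doubledConfig (pairsThrough (points (10 ∷ 11 ∷ []) ++ S))
  [] refl

bisectedConfig : Config 12
bisectedConfig = quad 8 9 10 11 ∷ quad 2 3 4 8 ∷ quad 5 6 7 8 ∷ []

-- The halves of `S` at 9 agree with those at 8 or arise by exchanging one point of each, in nine
-- ways.
bisected-leads : Leads bisectedConfig
bisected-leads = explore bisectedConfig (star (# 9) S)
  ((_ , doubled-leads) vias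
      ((2 ∷ 3 ∷ 4 ∷ 5 ∷ 6 ∷ 7 ∷ 8 ∷ 9 ∷ 10 ∷ 11 ∷ []) ∷ []) ++
   (_ , bisected²-leads) vias
      ((2 ∷ 3 ∷ 4 ∷ 5 ∷ 6 ∷ 7 ∷ 8 ∷ 9 ∷ 10 ∷ 11 ∷ []) ∷ (2 ∷ 3 ∷ 4 ∷ 6 ∷ 5 ∷ 7 ∷ 8 ∷ 9 ∷ 10 ∷ 11 ∷ []) ∷
       (2 ∷ 3 ∷ 4 ∷ 7 ∷ 5 ∷ 6 ∷ 8 ∷ 9 ∷ 10 ∷ 11 ∷ []) ∷ (2 ∷ 4 ∷ 3 ∷ 5 ∷ 6 ∷ 7 ∷ 8 ∷ 9 ∷ 10 ∷ 11 ∷ []) ∷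
       (2 ∷ 4 ∷ 3 ∷ 6 ∷ 5 ∷ 7 ∷ 8 ∷ 9 ∷ 10 ∷ 11 ∷ []) ∷ (2 ∷ 4 ∷ 3 ∷ 7 ∷ 5 ∷ 6 ∷ 8 ∷ 9 ∷ 10 ∷ 11 ∷ []) ∷
       (3 ∷ 4 ∷ 2 ∷ 7 ∷ 5 ∷ 6 ∷ 8 ∷ 9 ∷ 10 ∷ 11 ∷ []) ∷ (3 ∷ 4 ∷ 2 ∷ 6 ∷ 5 ∷ 7 ∷ 8 ∷ 9 ∷ 10 ∷ 11 ∷ []) ∷
       (3 ∷ 4 ∷ 2 ∷ 5 ∷ 6 ∷ 7 ∷ 8 ∷ 9 ∷ 10 ∷ 11 ∷ []) ∷ [])) refl

planeConfig : Config 12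
planeConfig = quad 8 9 10 11 ∷ []

-- The other two blocks through 8 split `S` into halves; the labellings are the ten ways to do so.
plane-leads : Leads planeConfig
plane-leads = explore planeConfig (star (# 8) S)
  ((_ , bisected-leads) vias
      ((2 ∷ 3 ∷ 4 ∷ 5 ∷ 6 ∷ 7 ∷ 8 ∷ 9 ∷ 10 ∷ 11 ∷ []) ∷ (2 ∷ 3 ∷ 5 ∷ 4 ∷ 6 ∷ 7 ∷ 8 ∷ 9 ∷ 10 ∷ 11 ∷ []) ∷
       (2 ∷ 3 ∷ 6 ∷ 4 ∷ 5 ∷ 7 ∷ 8 ∷ 9 ∷ 10 ∷ 11 ∷ []) ∷ (2 ∷ 3 ∷ 7 ∷ 4 ∷ 5 ∷ 6 ∷ 8 ∷ 9 ∷ 10 ∷ 11 ∷ []) ∷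
       (2 ∷ 4 ∷ 5 ∷ 3 ∷ 6 ∷ 7 ∷ 8 ∷ 9 ∷ 10 ∷ 11 ∷ []) ∷ (2 ∷ 4 ∷ 6 ∷ 3 ∷ 5 ∷ 7 ∷ 8 ∷ 9 ∷ 10 ∷ 11 ∷ []) ∷
       (2 ∷ 4 ∷ 7 ∷ 3 ∷ 5 ∷ 6 ∷ 8 ∷ 9 ∷ 10 ∷ 11 ∷ []) ∷ (2 ∷ 5 ∷ 6 ∷ 3 ∷ 4 ∷ 7 ∷ 8 ∷ 9 ∷ 10 ∷ 11 ∷ []) ∷
       (2 ∷ 5 ∷ 7 ∷ 3 ∷ 4 ∷ 6 ∷ 8 ∷ 9 ∷ 10 ∷ 11 ∷ []) ∷ (2 ∷ 6 ∷ 7 ∷ 3 ∷ 4 ∷ 5 ∷ 8 ∷ 9 ∷ 10 ∷ 11 ∷ []) ∷ [])) refl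

lineConfig : Config 12
lineConfig = quad 2 8 9 10 ∷ []

-- No completion exists: the three blocks through 11 contain one of 8, 9, 10 each, and the one
-- containing 2 would repeat a pair of 2 with a point of `Z`.
line-leads : Leads lineConfig
line-leads = explore lineConfig (pairsThrough (Z ++ S))
  [] refl

rootConfig : Config 12
rootConfig = []

root-leads : Leads rootConfig
root-leads = explore rootConfig (star (# 8) (# 9 ∷ []))
  ((_ , line-leads) vias
      ((2 ∷ 3 ∷ 4 ∷ 5 ∷ 6 ∷ 7 ∷ 8 ∷ 9 ∷ 10 ∷ 11 ∷ []) ∷ (2 ∷ 3 ∷ 4 ∷ 5 ∷ 6 ∷ 7 ∷ 8 ∷ 9 ∷ 11 ∷ 10 ∷ []) ∷
       (3 ∷ 2 ∷ 4 ∷ 5 ∷ 6 ∷ 7 ∷ 8 ∷ 9 ∷ 10 ∷ 11 ∷ []) ∷ (3 ∷ 2 ∷ 4 ∷ 5 ∷ 6 ∷ 7 ∷ 8 ∷ 9 ∷ 11 ∷ 10 ∷ []) ∷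
       (4 ∷ 2 ∷ 3 ∷ 5 ∷ 6 ∷ 7 ∷ 8 ∷ 9 ∷ 10 ∷ 11 ∷ []) ∷ (4 ∷ 2 ∷ 3 ∷ 5 ∷ 6 ∷ 7 ∷ 8 ∷ 9 ∷ 11 ∷ 10 ∷ []) ∷
       (5 ∷ 2 ∷ 3 ∷ 4 ∷ 6 ∷ 7 ∷ 8 ∷ 9 ∷ 10 ∷ 11 ∷ []) ∷ (5 ∷ 2 ∷ 3 ∷ 4 ∷ 6 ∷ 7 ∷ 8 ∷ 9 ∷ 11 ∷ 10 ∷ []) ∷
       (6 ∷ 2 ∷ 3 ∷ 4 ∷ 5 ∷ 7 ∷ 8 ∷ 9 ∷ 10 ∷ 11 ∷ []) ∷ (6 ∷ 2 ∷ 3 ∷ 4 ∷ 5 ∷ 7 ∷ 8 ∷ 9 ∷ 11 ∷ 10 ∷ []) ∷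
       (7 ∷ 2 ∷ 3 ∷ 4 ∷ 5 ∷ 6 ∷ 8 ∷ 9 ∷ 10 ∷ 11 ∷ []) ∷ (7 ∷ 2 ∷ 3 ∷ 4 ∷ 5 ∷ 6 ∷ 8 ∷ 9 ∷ 11 ∷ 10 ∷ []) ∷ []) ++
   (_ , plane-leads) vias
      ((2 ∷ 3 ∷ 4 ∷ 5 ∷ 6 ∷ 7 ∷ 8 ∷ 9 ∷ 10 ∷ 11 ∷ []) ∷ []) ++
   (_ , split-leads) vias
      ((2 ∷ 3 ∷ 4 ∷ 5 ∷ 6 ∷ 7 ∷ 8 ∷ 9 ∷ 10 ∷ 11 ∷ []) ∷ (2 ∷ 4 ∷ 3 ∷ 5 ∷ 6 ∷ 7 ∷ 8 ∷ 9 ∷ 10 ∷ 11 ∷ []) ∷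
       (2 ∷ 5 ∷ 3 ∷ 4 ∷ 6 ∷ 7 ∷ 8 ∷ 9 ∷ 10 ∷ 11 ∷ []) ∷ (2 ∷ 6 ∷ 3 ∷ 4 ∷ 5 ∷ 7 ∷ 8 ∷ 9 ∷ 10 ∷ 11 ∷ []) ∷
       (2 ∷ 7 ∷ 3 ∷ 4 ∷ 5 ∷ 6 ∷ 8 ∷ 9 ∷ 10 ∷ 11 ∷ []) ∷ (3 ∷ 4 ∷ 2 ∷ 5 ∷ 6 ∷ 7 ∷ 8 ∷ 9 ∷ 10 ∷ 11 ∷ []) ∷
       (3 ∷ 5 ∷ 2 ∷ 4 ∷ 6 ∷ 7 ∷ 8 ∷ 9 ∷ 10 ∷ 11 ∷ []) ∷ (3 ∷ 6 ∷ 2 ∷ 4 ∷ 5 ∷ 7 ∷ 8 ∷ 9 ∷ 10 ∷ 11 ∷ []) ∷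
       (3 ∷ 7 ∷ 2 ∷ 4 ∷ 5 ∷ 6 ∷ 8 ∷ 9 ∷ 10 ∷ 11 ∷ []) ∷ (4 ∷ 5 ∷ 2 ∷ 3 ∷ 6 ∷ 7 ∷ 8 ∷ 9 ∷ 10 ∷ 11 ∷ []) ∷
       (4 ∷ 6 ∷ 2 ∷ 3 ∷ 5 ∷ 7 ∷ 8 ∷ 9 ∷ 10 ∷ 11 ∷ []) ∷ (4 ∷ 7 ∷ 2 ∷ 3 ∷ 5 ∷ 6 ∷ 8 ∷ 9 ∷ 10 ∷ 11 ∷ []) ∷
       (5 ∷ 6 ∷ 2 ∷ 3 ∷ 4 ∷ 7 ∷ 8 ∷ 9 ∷ 10 ∷ 11 ∷ []) ∷ (5 ∷ 7 ∷ 2 ∷ 3 ∷ 4 ∷ 6 ∷ 8 ∷ 9 ∷ 10 ∷ 11 ∷ []) ∷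
       (6 ∷ 7 ∷ 2 ∷ 3 ∷ 4 ∷ 5 ∷ 8 ∷ 9 ∷ 10 ∷ 11 ∷ []) ∷ [])) refl

-- The pairing of the points by mates

module _ {𝓑 : List (Subset 12)} (t : Tight 𝓑) where

  private
    linked-labelled : ∀ x y ss zs → length ss ≡ 6 → length zs ≡ 4 → Unique (x ∷ y ∷ ss ++ zs) →
                      deg 𝓑 (x ∷ y ∷ []) ≤ 9 → All (λ z → deg 𝓑 (z ∷ x ∷ y ∷ []) ≤ 3) zs → Linked 𝓑 x y
    linked-labelled x y ss@(_ ∷ _ ∷ _ ∷ _ ∷ _ ∷ _ ∷ []) zs@(z₁ ∷ z₂ ∷ z₃ ∷ z₄ ∷ []) refl refl u le (t₁ ∷ t₂ ∷ t₃ ∷ t₄ ∷ []) =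
      linked-pull inj {𝓑} (root-leads marked [])
      where
      ρ : Vec Point 12
      ρ = labels (x ∷ y ∷ ss ++ zs) refl
      inj : Injective _≡_ _≡_ (lookup ρ)
      inj = labels-injective {L = x ∷ y ∷ ss ++ zs} refl u
      at : ∀ z → deg 𝓑 (map (lookup ρ) (z ∷ # 0 ∷ # 1 ∷ [])) ≤ 3 → deg (relabel ρ 𝓑) (z ∷ # 0 ∷ # 1 ∷ []) ≤ 3
      at z = subst (_≤ 3) (sym (deg-pull (lookup ρ) 𝓑 (z ∷ # 0 ∷ # 1 ∷ [])))
      marked : Marked (relabel ρ 𝓑)
      marked = record
        { tight   = tight-relabel inj t
        ; deg₀₁   = subst (_≤ 9) (sym (deg-pull (lookup ρ) 𝓑 (# 0 ∷ # 1 ∷ []))) le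
        ; tripled = at (# 8) t₁ ∷ at (# 9) t₂ ∷ at (# 10) t₃ ∷ at (# 11) t₄ ∷ []
        }

  linked : ∀ {x y} → Unique (x ∷ y ∷ []) → deg 𝓑 (x ∷ y ∷ []) ≤ 9 → Linked 𝓑 x y
  linked {x} {y} u@((x≢y ∷ []) ∷ _) le = linked-labelled x y (others (x ∷ y ∷ zs)) zs
    (trans (length-others unique) (cong (λ l → 12 ∸ suc (suc l)) four)) four
    (Unique-resp-↭ (↭.↭⇒↭ₛ (↭.↭-prep x (↭.↭-prep y (++-comm zs _)))) (others-++-unique unique))
    le (All.all-filter _ (others (x ∷ y ∷ [])))
    where
    open import Data.List.Relation.Binary.Permutation.Setoid.Properties (setoid Point) using (Unique-resp-↭)
    zs : List Point
    zs = filter (λ z → deg 𝓑 (z ∷ x ∷ y ∷ []) ℕ.≤? 3) (others (x ∷ y ∷ []))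
    four : length zs ≡ 4
    four = exactly-four t u le
    unique : Unique (x ∷ y ∷ zs)
    unique = keep (others-++-unique u)
      where
      keep : ∀ {ws} → Unique (x ∷ y ∷ ws) → Unique (x ∷ y ∷ filter (λ z → deg 𝓑 (z ∷ x ∷ y ∷ []) ℕ.≤? 3) ws)
      keep ((p ∷ x∉) ∷ y∉ ∷ v) = (p ∷ All.filter⁺ _ x∉) ∷ All.filter⁺ _ y∉ ∷ Unique.filter⁺ _ v

  mates-sym : ∀ {x y} → Mates t x y → Mates t y x
  mates-sym {x} {y} = subst (10 ≤_) (deg-↭ 𝓑 (y ∷ x ∷ []) (x ∷ y ∷ []) (↭.↭-swap y x ↭.↭-refl))

  mates-≡ : ∀ {x y z} → x ≢ y → x ≢ z → Mates t x y → Mates t x z → z ≡ y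
  mates-≡ {x} {y} {z} x≢y x≢z p q with z Fin.≟ y
  ... | yes eq = eq
  ... | no z≢y = contradiction q (mates-unique t ((z≢y ∷ ≢-sym x≢z ∷ []) ∷ (≢-sym x≢y ∷ []) ∷ [] ∷ []) p)

  -- A block containing a pair of mates contains the mate of each of its points.
  twin : ∀ {a a′ b b′} → Unique (a ∷ a′ ∷ b ∷ b′ ∷ []) → Mates t a a′ → Mates t b b′ →
         All (λ B → a ∷ a′ ∷ b ∷ [] ⊑ B ≡ true → a′ ∷ b′ ∷ a ∷ b ∷ [] ⊑ B ≡ true) 𝓑
  twin {a} {a′} {b} {b′} ((a≢a′ ∷ a≢b ∷ a≢b′ ∷ []) ∷ (a′≢b ∷ a′≢b′ ∷ []) ∷ (b≢b′ ∷ []) ∷ _) ma mb =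
    deg≥⇒⊑ 𝓑 (a ∷ a′ ∷ b ∷ []) (a′ ∷ b′ ∷ a ∷ b ∷ [])
      (λ { (here refl) → there (there (here refl)) ; (there (here refl)) → here refl ; (there (there (here refl))) → there (there (there (here refl))) })
      (ℕ.≤-trans (deg₃-≤ t ((a≢a′ ∷ a≢b ∷ []) ∷ (a′≢b ∷ []) ∷ [] ∷ [])) together)
    where
    le : deg 𝓑 (a ∷ b ∷ []) ≤ 9
    le = ℕ.≤-pred (ℕ.≰⇒> (mates-unique t ((a≢b′ ∷ a≢b ∷ []) ∷ (≢-sym b≢b′ ∷ []) ∷ [] ∷ []) mb))
    identify : Linked 𝓑 a b → 4 ≤ deg 𝓑 (a′ ∷ b′ ∷ a ∷ b ∷ [])
    identify (p , q , ((_ ∷ p≢a ∷ _) ∷ (_ ∷ q≢b ∷ []) ∷ _) , mp , mq , le₄) =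
      subst₂ (λ p q → 4 ≤ deg 𝓑 (p ∷ q ∷ a ∷ b ∷ [])) (mates-≡ a≢a′ (≢-sym p≢a) ma mp) (mates-≡ b≢b′ (≢-sym q≢b) mb mq) le₄
    together : 4 ≤ deg 𝓑 (a′ ∷ b′ ∷ a ∷ b ∷ [])
    together = identify (linked ((a≢b ∷ []) ∷ [] ∷ []) le)

  data Paired : List Point → Set where
    []   : Paired []
    pair : ∀ {x y zs} → Mates t x y → Paired zs → Paired (x ∷ y ∷ zs)

  paired-closed : ∀ {xs} → Unique xs → Paired xs → ∀ {x y} → x ∈ xs → x ≢ y → Mates t x y → y ∈ xs
  paired-closed ((a≢b ∷ _) ∷ _) (pair m ps) (here refl) x≢y m′ with refl ← mates-≡ a≢b x≢y m m′ = there (here refl)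
  paired-closed ((a≢b ∷ _) ∷ _) (pair m ps) (there (here refl)) x≢y m′ with refl ← mates-≡ (≢-sym a≢b) x≢y (mates-sym m) m′ = here refl
  paired-closed (_ ∷ _ ∷ u) (pair m ps) (there (there x∈)) x≢y m′ = there (there (paired-closed u ps x∈ x≢y m′))

  pairing : ∀ n → n * 2 ≤ 12 → ∃ λ xs → length xs ≡ n * 2 × Unique xs × Paired xs
  pairing zero    _  = [] , refl , [] , []
  pairing (suc n) le =
    let xs , len , u , ps = pairing n (ℕ.≤-trans (ℕ.m≤n+m (n * 2) 2) le)
        rest = trans (length-others u) (cong (12 ∸_) len)
        y , y∈ = first (subst (0 <_) (sym rest) (ℕ.m<n⇒0<n∸m (ℕ.≤-trans (ℕ.n≤1+n _) le)))
        y′ , v , m = mate t y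
        y′≢y = All.head (AllPairs.head v)
        y∉ = ∈-others y∈
        y′∉ = λ y′∈ → y∉ (paired-closed u ps y′∈ y′≢y (mates-sym m))
    in y ∷ y′ ∷ xs , cong (2 +_) len , (≢-sym y′≢y ∷ ∉⇒≢ y∉) ∷ ∉⇒≢ y′∉ ∷ u , pair m ps
    where
    first : ∀ {ys : List Point} → 0 < length ys → ∃ (_∈ ys)
    first {y ∷ _} _ = y , here refl

-- Transversals and the 4-cube

mateOf : Point → Point
mateOf = lookup (Vec.map (_mod 12) (1 ∷ 0 ∷ 3 ∷ 2 ∷ 5 ∷ 4 ∷ 7 ∷ 6 ∷ 9 ∷ 8 ∷ 11 ∷ 10 ∷ []))

record Mated (𝓑 : List (Subset 12)) : Set where
  field
    tight : Tight 𝓑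
    mates : ∀ i → Mates tight i (mateOf i)

-- A 6-set of this shape that contains a pair of mates is closed under mates; otherwise it has one
-- point from each pair.
twinned : Subset 12 → Bool
twinned B = all (λ a → all (λ b → not (a ∷ mateOf a ∷ b ∷ [] ⊑ B) ∨ lookup B (mateOf b)) (allFin 12)) (allFin 12)

mated-twinned : ∀ {𝓑} → Mated 𝓑 → All (λ B → twinned B ≡ true) 𝓑
mated-twinned {𝓑} md = All.tabulate λ {B} B∈ → all-intro (All.universal (λ a → all-intro (All.universal (λ b →
    implies (a ∷ mateOf a ∷ b ∷ [] ⊑ B) (at B∈ a b (b Fin.≟ a) (b Fin.≟ mateOf a))) (allFin 12))) (allFin 12))
  where
  implies : ∀ p {q} → (p ≡ true → q ≡ true) → not p ∨ q ≡ true
  implies false f = refl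
  implies true  f = f refl
  involution : ∀ i → mateOf (mateOf i) ≡ i
  involution = toWitness {a? = Fin.all? λ i → mateOf (mateOf i) Fin.≟ i} _
  distinct : ∀ a b → b ≢ a → b ≢ mateOf a → Unique (a ∷ mateOf a ∷ b ∷ mateOf b ∷ [])
  distinct = toWitness {a? = Fin.all? λ a → Fin.all? λ b →
    ¬? (b Fin.≟ a) →-dec ¬? (b Fin.≟ mateOf a) →-dec unique? (a ∷ mateOf a ∷ b ∷ mateOf b ∷ [])} _
  at : ∀ {B} → B ∈ 𝓑 → ∀ a b → Dec (b ≡ a) → Dec (b ≡ mateOf a) → a ∷ mateOf a ∷ b ∷ [] ⊑ B ≡ true → lookup B (mateOf b) ≡ true
  at {B} B∈ a b (yes refl) _          p = ⊑⇒∈ B (a ∷ mateOf a ∷ b ∷ []) p (there (here refl))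
  at {B} B∈ a b (no _)     (yes refl) p = ⊑⇒∈ B (a ∷ mateOf a ∷ b ∷ []) p (here (involution a))
  at {B} B∈ a b (no b≢a)   (no b≢a′)  p = ⊑⇒∈ B (mateOf a ∷ mateOf b ∷ a ∷ b ∷ [])
    (All.lookup (twin (Mated.tight md) (distinct a b b≢a b≢a′) (Mated.mates md a) (Mated.mates md b)) B∈ p) (there (here refl))

module _ {𝓑 : List (Subset 12)} (md : Mated 𝓑) where
  private
    cov : Cover 12 6 4 𝓑
    cov = Tight.cover (Mated.tight md)

  apart-≤ : ∀ z x {_ : True (unique? (z ∷ mateOf x ∷ x ∷ []))} → deg 𝓑 (z ∷ x ∷ []) ≤ 9
  apart-≤ z x {u} = ℕ.≤-pred (ℕ.≰⇒> (mates-unique (Mated.tight md) (toWitness u) (Mated.mates md x)))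

  apart-≥ : ∀ z x {_ : True (unique? (z ∷ x ∷ []))} → 9 ≤ deg 𝓑 (z ∷ x ∷ [])
  apart-≥ z x {u} = deg₂-≥ cov (toWitness u)

  mates-≤ : ∀ z x {_ : True (unique? (z ∷ mateOf x ∷ x ∷ []))} → deg 𝓑 (z ∷ mateOf x ∷ x ∷ []) ≤ 4
  mates-≤ z x {u} = deg₃-≤ (Mated.tight md) (toWitness u)

  mates-≥ : ∀ z x {_ : True (unique? (z ∷ mateOf x ∷ x ∷ []))} → 4 ≤ deg 𝓑 (z ∷ mateOf x ∷ x ∷ [])
  mates-≥ z x {u} = deg₃-mates-≥ (Mated.tight md) (toWitness u) (Mated.mates md x)

  quad-≥ : ∀ a b c d {_ : True (unique? (a ∷ b ∷ c ∷ d ∷ []))} → 1 ≤ deg 𝓑 (a ∷ b ∷ c ∷ d ∷ [])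
  quad-≥ a b c d {u} = deg₄-≥ cov (toWitness u)

-- A block through y but not through its mate is a transversal of the six pairs of mates.  Hence, with one point
-- chosen in each of four pairs, the degrees of the 16 quadruples add up to 9 − 4 = 5 on each 2-face of a 4-cube.
face : ∀ {𝓑} → Mated 𝓑 → ¬ All (λ xs → deg 𝓑 xs ≤ 1)
  (map points ((0 ∷ 2 ∷ 4 ∷ 6 ∷ []) ∷ (0 ∷ 3 ∷ 4 ∷ 6 ∷ []) ∷ (1 ∷ 2 ∷ 4 ∷ 6 ∷ []) ∷ (1 ∷ 3 ∷ 4 ∷ 6 ∷ []) ∷ []))
face md (q₁ ∷ q₂ ∷ q₃ ∷ q₄ ∷ []) = contradiction
  (dual-bound twinned 6 demand supply refl (Cover.sizes (Tight.cover (Mated.tight md))) (mated-twinned md)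
    (apart-≥ md (# 6) (# 4) ∷ [])
    (q₁ ∷ q₂ ∷ q₃ ∷ q₄ ∷ mates-≤ md (# 6) (# 4) ∷ []))
  (ℕ.<⇒≱ (ℕ.≤-refl {9}))
  where
  demand supply : List (Term 12)
  demand = (1 , points (6 ∷ 4 ∷ []) , 9) ∷ []
  supply = (1 , points (0 ∷ 2 ∷ 4 ∷ 6 ∷ []) , 1) ∷ (1 , points (0 ∷ 3 ∷ 4 ∷ 6 ∷ []) , 1)
    ∷ (1 , points (1 ∷ 2 ∷ 4 ∷ 6 ∷ []) , 1) ∷ (1 , points (1 ∷ 3 ∷ 4 ∷ 6 ∷ []) , 1) ∷ (1 , points (6 ∷ 5 ∷ 4 ∷ []) , 4) ∷ []

-- If the vertex 0000 of the cube has degree 2, the faces through it leave degree 1 for all vertices at distance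
-- at most 2; so 0111 and 1011 have degree 2, and the face ∗∗11 is too heavy.
vertex : ∀ {𝓑} → Mated 𝓑 → ¬ 2 ≤ deg 𝓑 (points (0 ∷ 2 ∷ 4 ∷ 6 ∷ []))
vertex md two = contradiction
  (dual-bound twinned 6 demand supply refl (Cover.sizes (Tight.cover (Mated.tight md))) (mated-twinned md)
    (two ∷ quad-≥ md (# 0) (# 2) (# 5) (# 6) ∷ quad-≥ md (# 0) (# 2) (# 4) (# 7) ∷ quad-≥ md (# 0) (# 3) (# 4) (# 6)
      ∷ quad-≥ md (# 1) (# 2) (# 4) (# 6) ∷ quad-≥ md (# 0) (# 2) (# 5) (# 7) ∷ quad-≥ md (# 1) (# 3) (# 5) (# 7)
      ∷ apart-≥ md (# 3) (# 0) ∷ apart-≥ md (# 2) (# 1) ∷ mates-≥ md (# 6) (# 0) ∷ mates-≥ md (# 4) (# 0)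
      ∷ mates-≥ md (# 6) (# 2) ∷ mates-≥ md (# 4) (# 2) ∷ mates-≥ md (# 7) (# 5) ∷ [])
    (mates-≤ md (# 3) (# 0) ∷ mates-≤ md (# 2) (# 1) ∷ apart-≤ md (# 6) (# 0) ∷ apart-≤ md (# 4) (# 0)
      ∷ apart-≤ md (# 6) (# 2) ∷ apart-≤ md (# 4) (# 2) ∷ apart-≤ md (# 7) (# 5) ∷ []))
  (ℕ.<⇒≱ (ℕ.≤-refl {54}))
  where
  demand supply : List (Term 12)
  -- Each bound on a pair is coupled with the opposite bound on a triple containing it, which
  -- together express a face sum 5: the faces at 3 0 and 2 1 from below, the other five from above.
  -- The totals are 54 against 53.
  demand = (4 , points (0 ∷ 2 ∷ 4 ∷ 6 ∷ []) , 2)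
    ∷ (2 , points (0 ∷ 2 ∷ 5 ∷ 6 ∷ []) , 1) ∷ (2 , points (0 ∷ 2 ∷ 4 ∷ 7 ∷ []) , 1)
    ∷ (1 , points (0 ∷ 3 ∷ 4 ∷ 6 ∷ []) , 1) ∷ (1 , points (1 ∷ 2 ∷ 4 ∷ 6 ∷ []) , 1)
    ∷ (1 , points (0 ∷ 2 ∷ 5 ∷ 7 ∷ []) , 1) ∷ (1 , points (1 ∷ 3 ∷ 5 ∷ 7 ∷ []) , 1)
    ∷ (1 , points (3 ∷ 0 ∷ []) , 9) ∷ (1 , points (2 ∷ 1 ∷ []) , 9)
    ∷ (1 , points (6 ∷ 1 ∷ 0 ∷ []) , 4) ∷ (1 , points (4 ∷ 1 ∷ 0 ∷ []) , 4)
    ∷ (1 , points (6 ∷ 3 ∷ 2 ∷ []) , 4) ∷ (1 , points (4 ∷ 3 ∷ 2 ∷ []) , 4) ∷ (1 , points (7 ∷ 4 ∷ 5 ∷ []) , 4) ∷ []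
  supply = (1 , points (3 ∷ 1 ∷ 0 ∷ []) , 4) ∷ (1 , points (2 ∷ 0 ∷ 1 ∷ []) , 4)
    ∷ (1 , points (6 ∷ 0 ∷ []) , 9) ∷ (1 , points (4 ∷ 0 ∷ []) , 9)
    ∷ (1 , points (6 ∷ 2 ∷ []) , 9) ∷ (1 , points (4 ∷ 2 ∷ []) , 9) ∷ (1 , points (7 ∷ 5 ∷ []) , 9) ∷ []

mated-relabel : ∀ ρ {_ : True (injective? (lookup ρ))} {_ : True (Fin.all? λ i → lookup ρ (mateOf i) Fin.≟ mateOf (lookup ρ i))} →
                ∀ {𝓑} → Mated 𝓑 → Mated (relabel ρ 𝓑)
mated-relabel ρ {inj} {comm} {𝓑} md = record
  { tight = tight-relabel (λ {i} {j} → toWitness inj i j) (Mated.tight md)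
  ; mates = λ i → subst (10 ≤_)
      (sym (trans (deg-pull (lookup ρ) 𝓑 (mateOf i ∷ i ∷ [])) (cong (λ a → deg 𝓑 (a ∷ lookup ρ i ∷ [])) (toWitness comm i))))
      (Mated.mates md (lookup ρ i))
  }

-- Interchanging two mates is a symmetry of the hypotheses, so the bound at one vertex holds at all
-- four vertices of a face.
¬mated : ∀ {𝓑} → ¬ Mated 𝓑
¬mated {𝓑} md = face md
  ( at (0 ∷ 1 ∷ 2 ∷ 3 ∷ 4 ∷ 5 ∷ 6 ∷ 7 ∷ 8 ∷ 9 ∷ 10 ∷ 11 ∷ [])
  ∷ at (0 ∷ 1 ∷ 3 ∷ 2 ∷ 4 ∷ 5 ∷ 6 ∷ 7 ∷ 8 ∷ 9 ∷ 10 ∷ 11 ∷ [])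
  ∷ at (1 ∷ 0 ∷ 2 ∷ 3 ∷ 4 ∷ 5 ∷ 6 ∷ 7 ∷ 8 ∷ 9 ∷ 10 ∷ 11 ∷ [])
  ∷ at (1 ∷ 0 ∷ 3 ∷ 2 ∷ 4 ∷ 5 ∷ 6 ∷ 7 ∷ 8 ∷ 9 ∷ 10 ∷ 11 ∷ [])
  ∷ [])
  where
  at : ∀ (v : Vec ℕ 12) → let ρ = Vec.map (_mod 12) v in
       {_ : True (injective? (lookup ρ))} {_ : True (Fin.all? λ i → lookup ρ (mateOf i) Fin.≟ mateOf (lookup ρ i))} →
       deg 𝓑 (map (lookup ρ) (points (0 ∷ 2 ∷ 4 ∷ 6 ∷ []))) ≤ 1
  at v {inj} {comm} = ℕ.≤-pred (ℕ.≰⇒> λ two → vertex (mated-relabel ρ {inj} {comm} md)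
    (subst (2 ≤_) (sym (deg-pull (lookup ρ) 𝓑 (points (0 ∷ 2 ∷ 4 ∷ 6 ∷ [])))) two))
    where
    ρ : Vec Point 12
    ρ = Vec.map (_mod 12) v

¬paired : ∀ {𝓑} (t : Tight 𝓑) xs → length xs ≡ 12 → Unique xs → ¬ Paired t xs
¬paired {𝓑} t xs@(a ∷ a′ ∷ b ∷ b′ ∷ c ∷ c′ ∷ d ∷ d′ ∷ e ∷ e′ ∷ f ∷ f′ ∷ []) refl u
  (pair ma (pair mb (pair mc (pair md (pair me (pair mf [])))))) = ¬mated record
    { tight = tight-relabel inj t
    ; mates = λ i → subst (10 ≤_) (sym (deg-pull (lookup ρ) 𝓑 (mateOf i ∷ i ∷ []))) (All.lookup ms (∈-allFin i))
    }
  where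
  ρ : Vec Point 12
  ρ = labels xs refl
  inj : Injective _≡_ _≡_ (lookup ρ)
  inj = labels-injective {L = xs} refl u
  ms : All (λ i → 10 ≤ deg 𝓑 (lookup ρ (mateOf i) ∷ lookup ρ i ∷ [])) (allFin 12)
  ms = ma ∷ mates-sym t ma ∷ mb ∷ mates-sym t mb ∷ mc ∷ mates-sym t mc
    ∷ md ∷ mates-sym t md ∷ me ∷ mates-sym t me ∷ mf ∷ mates-sym t mf ∷ []

¬tight : ∀ {𝓑} → ¬ Tight 𝓑
¬tight t = let xs , len , u , ps = pairing t 6 ℕ.≤-refl in ¬paired t xs len u ps

-- The four bounds

covering₁₂ : ∀ {𝓑} → Cover 12 6 4 𝓑 → 41 ≤ length 𝓑
covering₁₂ cov = ℕ.≰⇒> λ few → ¬tight record { cover = cov ; few = few }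

-- The margin is a single unit: 13 · 41 = 533 and 7 · 76 = 532.
covering₁₃ : ∀ {𝓑} → Cover 13 7 5 𝓑 → 77 ≤ length 𝓑
covering₁₃ cov = ℕ.*-cancelˡ-< 7 76 _ (schönheim covering₁₂ cov)

covering₁₄ : ∀ {𝓑} → Cover 14 8 6 𝓑 → 135 ≤ length 𝓑
covering₁₄ cov = ℕ.*-cancelˡ-< 8 134 _ (ℕ.≤-trans (ℕ.m≤m+n 1073 5) (schönheim covering₁₃ cov))

covering₁₅ : ∀ {𝓑} → Cover 15 9 7 𝓑 → 225 ≤ length 𝓑
covering₁₅ cov = ℕ.*-cancelˡ-≤ 9 (schönheim covering₁₄ cov)

covering₁₆ : ∀ {𝓑} → Cover 16 10 8 𝓑 → 360 ≤ length 𝓑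
covering₁₆ cov = ℕ.*-cancelˡ-≤ 10 (schönheim covering₁₅ cov)

C-≥ : ∀ {v k t c} {t≤k : True (t ℕ.≤? k)} {k≤v : True (k ℕ.≤? v)} →
      (∀ {𝓑} → Cover v k t 𝓑 → c ≤ length 𝓑) → C v k t {t≤k} {k≤v} ≥ c
C-≥ {v} {k} {t} bound with IsMinimum.attained (C-isMinimum v k t)
... | 𝓑 , covering , len = subst (_ ≤_) len (bound (isCovering⇒cover covering))

corollary17 : (C 13 7 5 ≥ 77) × (C 14 8 6 ≥ 135) × (C 15 9 7 ≥ 225) × (C 16 10 8 ≥ 360)
corollary17 = C-≥ covering₁₃ , C-≥ covering₁₄ , C-≥ covering₁₅ , C-≥ covering₁₆
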